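{- Let $(\Sigma,\theta)$ be a Noetherian space and $\alpha$ an ordinal. The set $T_\alpha(\Sigma)$ of $\alpha$-branching trees endowed with the ordinal tree topology is a Noetherian space.
   Context: Noetherian space: every subset is compact. $\le$ denotes the specialisation preorder of $\theta$ ($x\le y$ iff every open containing $x$ contains $y$). For a set $A$ and ordinal $\alpha$, $A^{<\alpha}$ is the set of transfinite words $w=(w_\gamma)_{\gamma<|w|}$ of ordinal length $|w|<\alpha$. Given a preorder $\le_A$ on $A$, the (ordinal) Higman ordering on $A^{<\alpha}$ is: $u\le^* w$ iff there is a strictly increasing $h:|u|\to|w|$ with $u_\gamma\le_A w_{h(\gamma)}$ for all $\gamma<|u|$. For a topology $\tau$ on $A$, the ordinal subword topology on $A^{<\alpha}$ is the topology whose closed sets are generated (as a subbasis of closed sets) by the sets $F_1^{<\beta_1}\cdots F_n^{<\beta_n}$ ($n\in\mathbb N$, $F_i$ closed in $\tau$, $\beta_i$ ordinals), where $F^{<\beta}$ is the set of words of length $<\beta$ all of whose letters are in $F$ and juxtaposition is concatenation of sets of words. The set $T_\alpha(\Sigma)$ of $\alpha$-branching trees is the least set containing a distinguished leaf $\star$ and all $a\langle w\rangle$ with $a\in\Sigma$ and $w\in T_\alpha(\Sigma)^{<\alpha}$ (the least fixed point of $X\mapsto\{\star\}+\Sigma\times X^{<\alpha}$). The embedding preorder $\le_T$ on $T_\alpha(\Sigma)$ is defined by well-founded recursion: $s\le_T t$ iff $s=\star$; or $t=a\langle (t_\gamma)_\gamma\rangle$ and $s\le_T t_\gamma$ for some $\gamma$;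 or $s=b\langle u\rangle$, $t=a\langle w\rangle$, $b\le a$ and $u\le_T^* w$. For $U\subseteq\Sigma$ and $V\subseteq T_\alpha(\Sigma)^{<\alpha}$, $U\langle V\rangle$ is the set of trees $a\langle w\rangle$ with $a\in U$ and $w\in V$. Let $R$ map a topology $\tau$ on $T_\alpha(\Sigma)$ to the topology generated by the sets $\uparrow_{\le_T}U\langle V\rangle$ (upward closure) where $U\in\theta$ and $V$ is open in $T_\alpha(\Sigma)^{<\alpha}$ for the ordinal subword topology built from $\tau$. The ordinal tree topology is the least fixed point of $R$ (for inclusion of topologies). -}

module Defs where

open import Data.Empty.Polymorphic using (⊥)
open import Data.List.Base using (List; []; _∷_)
open import Data.List.Relation.Unary.All using (All; []; _∷_)
open import Data.List.Relation.Unary.Any using (Any)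
open import Data.Product.Base using (Σ-syntax; ∃-syntax; _×_; _,_; proj₁)
open import Data.Refinement using (Refinement; value)
open import Data.Refinement.Properties using (value-injective)
open import Data.Sum.Base using (_⊎_; [_,_])
open import Data.Sum.Relation.Binary.LeftOrder
  using (_⊎-<_; ⊎-<-transitive; ⊎-<-trichotomous; ⊎-<-wellFounded)
open import Data.Sum.Relation.Binary.Pointwise
  using (Pointwise-≡⇒≡; ≡⇒Pointwise-≡)
open import Function.Base using (_∘_; _on_)
open import Induction.WellFounded using (WellFounded)
open import Level using (Level; _⊔_; suc)
open import Relation.Binary.Core using (Rel; _Preserves_⟶_)
open import Relation.Binary.Definitions using (tri<; tri≈; tri>; Trichotomous)
open import Relation.Binary.Morphism.Structures using (IsOrderIsomorphism)
open import Relation.Binary.PropositionalEquality using (_≡_; cong; isEquivalence)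
open import Relation.Binary.Structures using (IsStrictTotalOrder)
open import Relation.Nullary.Negation using (¬_)
open import Relation.Unary using (Pred; _∈_; _⊆_; _≐_; _∩_; ∁; ⋃)
open import Relation.Unary.Polymorphic using (U)
import Relation.Binary.Construct.On as On

private
  variable
    ℓ x q r s : Level

-- Ordinals are well-ordered types, compared up to order isomorphism.
record Ordinal (ℓ : Level) : Set (suc ℓ) where
  infix 4 _<_
  field
    Carrier            : Set ℓ
    _<_                : Rel Carrier ℓ
    isStrictTotalOrder : IsStrictTotalOrder _≡_ _<_
    <-wellFounded      : WellFounded _<_

  open IsStrictTotalOrder isStrictTotalOrder public
    using (compare) renaming (trans to <-trans)

⟪_⟫ : Ordinal ℓ → Set ℓ
⟪ α ⟫ = Ordinal.Carrier α

_[_<_] : (α : Ordinal ℓ) → ⟪ α ⟫ → ⟪ α ⟫ → Set ℓ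
α [ γ < δ ] = Ordinal._<_ α γ δ

-- The initial segment { δ ∈ α ∣ δ < γ }.  This is the von Neumann reading
-- of an element γ of α as an ordinal smaller than α.  The bound is carried
-- irrelevantly, so that an element of the segment is determined by its value.
_↓_ : (α : Ordinal ℓ) → ⟪ α ⟫ → Ordinal ℓ
α ↓ γ = record
  { Carrier            = Segment
  ; _<_                = _<↓_
  ; isStrictTotalOrder = record
    { isStrictPartialOrder = record
      { isEquivalence = isEquivalence
      ; irrefl        = λ eq → irrefl (cong value eq)
      ; trans         = trans
      ; <-resp-≈      = (λ { _≡_.refl p → p }) , (λ { _≡_.refl p → p })
      }
    ; compare = compare↓
    }
  ; <-wellFounded      = On.wellFounded value (Ordinal.<-wellFounded α)
  }
  where
  open IsStrictTotalOrder (Ordinal.isStrictTotalOrder α)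
    using (irrefl; trans; compare)

  Segment : Set _
  Segment = Refinement ⟪ α ⟫ (λ δ → α [ δ < γ ])

  _<↓_ : Rel Segment _
  _<↓_ = Ordinal._<_ α on value

  compare↓ : Trichotomous _≡_ _<↓_
  compare↓ i j with compare (value i) (value j)
  ... | tri< p ¬q ¬r = tri< p (¬q ∘ cong value) ¬r
  ... | tri≈ ¬p q ¬r = tri≈ ¬p (value-injective q) ¬r
  ... | tri> ¬p ¬q r = tri> ¬p (¬q ∘ cong value) r

_⊕_ : Ordinal ℓ → Ordinal ℓ → Ordinal ℓ
α ⊕ β = record
  { Carrier            = ⟪ α ⟫ ⊎ ⟪ β ⟫
  ; _<_                = _<⊕_
  ; isStrictTotalOrder = record
    { isStrictPartialOrder = record
      { isEquivalence = isEquivalence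
      ; irrefl        = λ { {i} _≡_.refl p → irrefl⊕ i p }
      ; trans         = ⊎-<-transitive (Ordinal.<-trans α) (Ordinal.<-trans β)
      ; <-resp-≈      = (λ { _≡_.refl p → p }) , (λ { _≡_.refl p → p })
      }
    ; compare = compare⊕
    }
  ; <-wellFounded      =
      ⊎-<-wellFounded (Ordinal.<-wellFounded α) (Ordinal.<-wellFounded β)
  }
  where
  _<⊕_ : Rel (⟪ α ⟫ ⊎ ⟪ β ⟫) _
  _<⊕_ = Ordinal._<_ α ⊎-< Ordinal._<_ β

  compare⊕ : Trichotomous _≡_ _<⊕_
  compare⊕ i j with ⊎-<-trichotomous (Ordinal.compare α) (Ordinal.compare β) i j
  ... | tri< p ¬q ¬r = tri< p (¬q ∘ ≡⇒Pointwise-≡) ¬r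
  ... | tri≈ ¬p q ¬r = tri≈ ¬p (Pointwise-≡⇒≡ q) ¬r
  ... | tri> ¬p ¬q r = tri> ¬p (¬q ∘ ≡⇒Pointwise-≡) r

  irrefl⊕ : ∀ i → ¬ (i <⊕ i)
  irrefl⊕ i p with compare⊕ i i
  ... | tri< _ ¬q _ = ¬q _≡_.refl
  ... | tri≈ ¬p _ _ = ¬p p
  ... | tri> _ ¬q _ = ¬q _≡_.refl

infix 4 _≅_ _≺_

IsIso : (α : Ordinal ℓ) (β : Ordinal ℓ) → (⟪ α ⟫ → ⟪ β ⟫) → Set ℓ
IsIso α β = IsOrderIsomorphism _≡_ _≡_ (Ordinal._<_ α) (Ordinal._<_ β)

_≅_ : Ordinal ℓ → Ordinal ℓ → Set ℓ
α ≅ β = ∃[ f ] IsIso α β f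

_≺_ : Ordinal ℓ → Ordinal ℓ → Set ℓ
α ≺ β = ∃[ b ] α ≅ (β ↓ b)

-- Word α X is X^{<α}: the length of a word is the ordinal α ↓ top.
record Word (α : Ordinal ℓ) (X : Set x) : Set (ℓ ⊔ x) where
  constructor word
  field
    top    : ⟪ α ⟫
    letter : ⟪ α ↓ top ⟫ → X

open Word public

module _ {α : Ordinal ℓ} {X : Set x} where

  ∣_∣ : Word α X → Ordinal ℓ
  ∣ w ∣ = α ↓ top w

  Higman : Rel X r → Rel (Word α X) (ℓ ⊔ r)
  Higman _≼_ u w =
    Σ[ h ∈ (⟪ ∣ u ∣ ⟫ → ⟪ ∣ w ∣ ⟫) ]
      (h Preserves Ordinal._<_ ∣ u ∣ ⟶ Ordinal._<_ ∣ w ∣) ×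
      (∀ γ → letter u γ ≼ letter w (h γ))

  IsConcat : Word α X → Word α X → Word α X → Set (ℓ ⊔ x)
  IsConcat u v w =
    Σ[ f ∈ (⟪ ∣ u ∣ ⊕ ∣ v ∣ ⟫ → ⟪ ∣ w ∣ ⟫) ]
      IsIso (∣ u ∣ ⊕ ∣ v ∣) ∣ w ∣ f ×
      (∀ i → letter w (f i) ≡ [ letter u , letter v ] i)

  -- All factors of a word of length < α again have length < α, so the
  -- concatenations that land in X^{<α} only involve words of X^{<α}.
  _·_ : Pred (Word α X) r → Pred (Word α X) s → Pred (Word α X) (ℓ ⊔ x ⊔ r ⊔ s)
  (L · M) w = ∃[ u ] ∃[ v ] u ∈ L × v ∈ M × IsConcat u v w

  _^<_ : Pred X q → Ordinal ℓ → Pred (Word α X) (ℓ ⊔ q)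
  (F ^< β) w = ∣ w ∣ ≺ β × (∀ γ → letter w γ ∈ F)

-- The product F₁^{<β₁} ⋯ Fₙ^{<βₙ}; the empty product is { ε }.
product : {α : Ordinal ℓ} {X : Set ℓ} →
          List (Pred X q × Ordinal ℓ) → Pred (Word α X) (ℓ ⊔ q)
product {ℓ = ℓ} {q = q} []    = λ w → ⟪ ∣ w ∣ ⟫ → ⊥ {ℓ ⊔ q}
product ((F , β) ∷ Fs)        = (F ^< β) · product Fs

-- Subsets of X are predicates at level q and families are indexed by types
-- at level q.  Below, q is always at least the level of X; then, under
-- excluded middle, every family of subsets (of any size) has the same
-- members, up to _≐_, as one indexed by a type at level q.
record Topology (X : Set x) (q : Level) : Set (suc (x ⊔ suc q)) where
  field
    Open   : Pred (Pred X q) (x ⊔ suc q)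
    resp   : ∀ {P Q} → P ≐ Q → Open P → Open Q
    open-U : Open U
    open-∩ : ∀ {P Q} → Open P → Open Q → Open (P ∩ Q)
    open-⋃ : (I : Set q) (P : I → Pred X q) → (∀ i → Open (P i)) → Open (⋃ I P)

open Topology public using (Open)

data Generated {X : Set x} (B : Pred (Pred X q) r) : Pred (Pred X q) (x ⊔ suc q ⊔ r) where
  basic : ∀ {P} → B P → Generated B P
  resp  : ∀ {P Q} → P ≐ Q → Generated B P → Generated B Q
  gen-U : Generated B U
  gen-∩ : ∀ {P Q} → Generated B P → Generated B Q → Generated B (P ∩ Q)
  gen-⋃ : (I : Set q) (P : I → Pred X q) →
          (∀ i → Generated B (P i)) → Generated B (⋃ I P)

generated : {X : Set x} → Pred (Pred X q) (x ⊔ suc q) → Topology X q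
generated B = record
  { Open   = Generated B
  ; resp   = resp
  ; open-U = gen-U
  ; open-∩ = gen-∩
  ; open-⋃ = gen-⋃
  }

module _ {X : Set x} (τ : Topology X q) where

  Specialisation : Rel X (x ⊔ suc q)
  Specialisation y z = ∀ P → P ∈ Open τ → y ∈ P → z ∈ P

  Compact : Pred (Pred X q) (x ⊔ suc q)
  Compact S = (I : Set q) (P : I → Pred X q) → (∀ i → P i ∈ Open τ) →
              S ⊆ ⋃ I P →
              Σ[ is ∈ List I ] (∀ {y} → y ∈ S → Any (λ i → y ∈ P i) is)

  Noetherian : Set (x ⊔ suc q)
  Noetherian = ∀ S → Compact S

-- SubwordBasis and TreeBasis take the collection of open sets rather than the
-- topology, because the ordinal tree topology is defined inductively from them.
module _ {X : Set ℓ} (α : Ordinal ℓ) (O : Pred (Pred X q) r) where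

  SubwordBasis : Pred (Pred (Word α X) (ℓ ⊔ q)) (suc ℓ ⊔ suc q ⊔ r)
  SubwordBasis V = Σ[ Fs ∈ List (Pred X q × Ordinal ℓ) ]
                     All (λ Fβ → ∁ (proj₁ Fβ) ∈ O) Fs × V ≐ ∁ (product Fs)

  SubwordOpen : Pred (Pred (Word α X) (ℓ ⊔ q)) (suc ℓ ⊔ suc q ⊔ r)
  SubwordOpen = Generated SubwordBasis

subwordTopology : {X : Set ℓ} (α : Ordinal ℓ) →
                  Topology X q → Topology (Word α X) (ℓ ⊔ q)
subwordTopology α τ = generated (SubwordBasis α (Open τ))

data Tree (α : Ordinal ℓ) (A : Set ℓ) : Set ℓ where
  ⋆    : Tree α A
  _⟨_⟩ : A → Word α (Tree α A) → Tree α A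

module _ {α : Ordinal ℓ} {A : Set ℓ} where

  data Embeds (_≼_ : Rel A r) : Rel (Tree α A) (ℓ ⊔ r) where
    leaf  : ∀ {t} → Embeds _≼_ ⋆ t
    child : ∀ {s a w} γ → Embeds _≼_ s (letter w γ) → Embeds _≼_ s (a ⟨ w ⟩)
    node  : ∀ {b a u w} → b ≼ a → Higman (Embeds _≼_) u w →
            Embeds _≼_ (b ⟨ u ⟩) (a ⟨ w ⟩)

  data _⟨_⟩ₛ (P : Pred A r) (V : Pred (Word α (Tree α A)) s) : Pred (Tree α A) (ℓ ⊔ r ⊔ s) where
    node : ∀ {a w} → a ∈ P → w ∈ V → (P ⟨ V ⟩ₛ) (a ⟨ w ⟩)

↑ : {X : Set x} → Rel X r → Pred X s → Pred X (x ⊔ r ⊔ s)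
↑ _≼_ P y = ∃[ z ] z ∈ P × z ≼ y

-- Specialisation quantifies over all open sets, so predicatively _≤ₜ_ lives
-- one level above A; subsets of trees are therefore predicates at level suc ℓ.
module _ {A : Set ℓ} (θ : Topology A ℓ) (α : Ordinal ℓ) where

  _≤ₜ_ : Rel (Tree α A) (suc ℓ)
  _≤ₜ_ = Embeds (Specialisation θ)

  TreeBasis : Pred (Pred (Tree α A) (suc ℓ)) r →
              Pred (Pred (Tree α A) (suc ℓ)) (suc (suc ℓ) ⊔ r)
  TreeBasis O W =
    Σ[ P ∈ Pred A ℓ ] Σ[ V ∈ Pred (Word α (Tree α A)) (suc ℓ) ]
      P ∈ Open θ × V ∈ SubwordOpen α O × W ≐ ↑ _≤ₜ_ (P ⟨ V ⟩ₛ)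

  R : Topology (Tree α A) (suc ℓ) → Topology (Tree α A) (suc ℓ)
  R τ = generated (TreeBasis (Open τ))

  -- The open sets of the least fixed point of R; that it is one is
  -- treeTopology-fixed and treeTopology-least.
  data TreeOpen : Pred (Pred (Tree α A) (suc ℓ)) (suc (suc ℓ)) where
    fix : ∀ {W} → Generated (TreeBasis TreeOpen) W → TreeOpen W

  unfix : ∀ {W} → TreeOpen W → Generated (TreeBasis TreeOpen) W
  unfix (fix g) = g

  treeTopology : Topology (Tree α A) (suc ℓ)
  treeTopology = record
    { Open   = TreeOpen
    ; resp   = λ P≐Q p → fix (resp P≐Q (unfix p))
    ; open-U = fix gen-U
    ; open-∩ = λ p q → fix (gen-∩ (unfix p) (unfix q))
    ; open-⋃ = λ I P p → fix (gen-⋃ I P (λ i → unfix (p i)))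
    }

  treeTopology-fixed : Open (R treeTopology) ≐ Open treeTopology
  treeTopology-fixed = fix , unfix

  module _ (τ : Topology (Tree α A) (suc ℓ)) (Rτ⊆τ : Open (R τ) ⊆ Open τ) where

    treeTopology-least : Open treeTopology ⊆ Open τ
    private
      foldTree : ∀ {W} → Generated (TreeBasis TreeOpen) W →
                 Generated (TreeBasis (Open τ)) W
      foldWord : ∀ {V} → SubwordOpen α TreeOpen V → SubwordOpen α (Open τ) V
      foldAll  : ∀ {Fs : List (Pred (Tree α A) (suc ℓ) × Ordinal ℓ)} →
                 All (λ Fβ → ∁ (proj₁ Fβ) ∈ TreeOpen) Fs →
                 All (λ Fβ → ∁ (proj₁ Fβ) ∈ Open τ) Fs

    treeTopology-least (fix g) = Rτ⊆τ (foldTree g)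

    foldTree (basic (P , V , p , v , eq)) = basic (P , V , p , foldWord v , eq)
    foldTree (resp eq g)                  = resp eq (foldTree g)
    foldTree gen-U                        = gen-U
    foldTree (gen-∩ g h)                  = gen-∩ (foldTree g) (foldTree h)
    foldTree (gen-⋃ I P g)                = gen-⋃ I P (λ i → foldTree (g i))

    foldWord (basic (Fs , c , eq)) = basic (Fs , foldAll c , eq)
    foldWord (resp eq g)           = resp eq (foldWord g)
    foldWord gen-U                 = gen-U
    foldWord (gen-∩ g h)           = gen-∩ (foldWord g) (foldWord h)
    foldWord (gen-⋃ I P g)         = gen-⋃ I P (λ i → foldWord (g i))

    foldAll []       = []
    foldAll (c ∷ cs) = treeTopology-least c ∷ foldAll cs

{-# OPTIONS --safe #-}
-- Call a sequence bad if some closed sets Cᵢ satisfy xᵢ ∉ Cᵢ and xⱼ ∈ Cᵢ for i < j,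
-- and self-convergent if every closed set containing infinitely many of its terms
-- contains all of them.  A space is Noetherian iff it has no bad sequence, iff every
-- sequence has a self-convergent subsequence; the latter can be tested on a subbasis.
-- In a minimal bad sequence aᵢ⟨wᵢ⟩ of trees the subtrees form a Noetherian space Y, so
-- it suffices that the words over Y do: then aᵢ and wᵢ can be made self-convergent,
-- which contradicts badness.
-- For words, take a minimal bad sequence with respect to the prefix order and write each
-- word as uᵢvᵢ with vᵢ a nonempty tail all of whose nonempty tails have the same length
-- and the same closure.  The uᵢ range over a Noetherian space by minimality; for the vᵢ a
-- product is equivalent to a condition on one factor, and monotone conditions on lengths
-- and closures have no bad sequences.  Finally, concatenation preserves self-convergence:
-- the ways to cut an ordinal bound β into γ and the rest of β leave finitely many rests.
module Submission where

open import Defs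
open import Axiom.ExcludedMiddle using (ExcludedMiddle)
open import Data.Empty using (⊥)
open import Data.Irrelevant using ([_])
open import Data.List.Base using (List; []; _∷_; _++_; _∷ʳ_; map)
open import Data.List.Extrema.Nat using (max; xs≤max)
open import Data.List.Properties using (∷ʳ-++)
open import Data.List.Relation.Unary.All as All using (All; []; _∷_)
import Data.List.Relation.Unary.All.Properties as All
open import Data.List.Relation.Unary.Any using (Any; here; there)
open import Data.Nat.Base as ℕ using (ℕ; zero; suc; s≤s; z≤n)
import Data.Nat.Induction as ℕ
import Data.Nat.Properties as ℕ
open import Data.Product.Base using (Σ-syntax; ∃-syntax; _×_; _,_; proj₁; proj₂)
open import Data.Refinement using (value; _,_)
open import Data.Refinement.Properties using (value-injective)
open import Data.Sum.Base as Sum using (_⊎_; inj₁; inj₂)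
open import Data.Sum.Relation.Binary.LeftOrder using (₁∼₁; ₁∼₂; ₂∼₂)
open import Data.Unit.Polymorphic.Base using (⊤; tt)
open import Function.Base using (_∘_; id; case_of_)
open import Induction.WellFounded using (WellFounded; Acc; acc)
open import Level using (Level; _⊔_; Lift; lift; lower) renaming (suc to lsuc)
open import Relation.Binary.Core using (Rel; REL)
open import Relation.Binary.Definitions using (tri<; tri≈; tri>)
open import Relation.Binary.Morphism.Structures using (IsOrderIsomorphism)
open import Relation.Binary.PropositionalEquality using (_≡_; refl; sym; trans; cong; subst)
open import Relation.Binary.Structures using (IsStrictTotalOrder)
open import Relation.Nullary.Decidable using (yes; no; decidable-stable; recompute)
open import Relation.Nullary.Negation using (¬_; contradiction)
open import Relation.Unary using (Pred; _∈_; ∁)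

private
  variable
    a k m p q r s x z ℓ : Level

-- Infinite and cofinite sets of indices.

Increasing : (ℕ → ℕ) → Set
Increasing φ = ∀ i j → i ℕ.< j → φ i ℕ.< φ j

Infinitely : Pred ℕ p → Set p
Infinitely P = ∀ N → ∃[ n ] N ℕ.≤ n × P n

Eventually : Pred ℕ p → Set p
Eventually P = ∃[ N ] ∀ n → N ℕ.≤ n → P n

increasing-≥ : ∀ {φ} → Increasing φ → ∀ n → n ℕ.≤ φ n
increasing-≥ inc zero    = z≤n
increasing-≥ inc (suc n) = ℕ.≤-<-trans (increasing-≥ inc n) (inc _ _ ℕ.≤-refl)

step⇒increasing : ∀ {φ : ℕ → ℕ} → (∀ n → φ n ℕ.< φ (suc n)) → Increasing φ
step⇒increasing {φ} step _ _ i<j = go (ℕ.≤⇒≤′ i<j)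
  where
  go : ∀ {i j} → suc i ℕ.≤′ j → φ i ℕ.< φ j
  go ℕ.≤′-refl       = step _
  go (ℕ.≤′-step i<j) = ℕ.<-trans (go i<j) (step _)

module _ {P : Pred ℕ p} {Q : Pred ℕ r} where

  Infinitely-map : (∀ n → P n → Q n) → Infinitely P → Infinitely Q
  Infinitely-map f inf N = let n , N≤n , Pn = inf N in n , N≤n , f n Pn

  Infinitely-map≥ : ∀ M → (∀ n → M ℕ.≤ n → P n → Q n) → Infinitely P → Infinitely Q
  Infinitely-map≥ M f inf N =
    let n , le , Pn = inf (N ℕ.⊔ M)
    in n , ℕ.≤-trans (ℕ.m≤m⊔n N M) le , f n (ℕ.≤-trans (ℕ.m≤n⊔m N M) le) Pn

Infinitely-reindex : ∀ {P : Pred ℕ p} {φ} → Increasing φ → Infinitely (P ∘ φ) → Infinitely P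
Infinitely-reindex {φ = φ} inc inf N =
  let n , N≤n , Pφn = inf N in φ n , ℕ.≤-trans N≤n (increasing-≥ inc n) , Pφn

Eventually⇒Infinitely : {P : Pred ℕ p} → Eventually P → Infinitely P
Eventually⇒Infinitely (M , f) N = N ℕ.⊔ M , ℕ.m≤m⊔n N M , f _ (ℕ.m≤n⊔m N M)

abstract
  enumerate : {P : Pred ℕ p} → Infinitely P →
              ∀ N → ∃[ φ ] Increasing φ × (∀ n → N ℕ.≤ φ n × P (φ n))
  enumerate {P = P} inf N = φ , step⇒increasing step , good
    where
    φ : ℕ → ℕ
    φ zero    = proj₁ (inf N)
    φ (suc n) = proj₁ (inf (suc (φ n)))

    step : ∀ n → φ n ℕ.< φ (suc n)
    step n = proj₁ (proj₂ (inf (suc (φ n))))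

    good : ∀ n → N ℕ.≤ φ n × P (φ n)
    good zero    = proj₂ (inf N)
    good (suc n) = ℕ.≤-trans (proj₁ (good n)) (ℕ.<⇒≤ (step n)) , proj₂ (proj₂ (inf (suc (φ n))))

-- Bad and self-convergent sequences.

-- A space is presented by a subbasis of closed sets: a type K of codes with
-- a membership relation between points and codes.
record Bad {Z : Set z} {K : Set k} (_∈_ : REL Z K m) : Set (z ⊔ k ⊔ m) where
  field
    point   : ℕ → Z
    closed  : ℕ → K
    escapes : ∀ n → ¬ (point n ∈ closed n)
    later   : ∀ {i j} → i ℕ.< j → point j ∈ closed i

  tail : ℕ → Bad _∈_
  tail N = record
    { point   = λ n → point (n ℕ.+ N)
    ; closed  = λ n → closed (n ℕ.+ N)
    ; escapes = λ n → escapes (n ℕ.+ N)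
    ; later   = λ i<j → later (ℕ.+-monoˡ-< N i<j)
    }

NoBad : {Z : Set z} {K : Set k} → REL Z K m → Set (z ⊔ k ⊔ m)
NoBad _∈_ = ¬ Bad _∈_

SelfConvergent : {Z : Set z} {K : Set k} → REL Z K m → (ℕ → Z) → Set (k ⊔ m)
SelfConvergent _∈_ x = ∀ C → Infinitely (λ n → x n ∈ C) → ∀ n → x n ∈ C

-- All terms after the first lie in `closed (φ 0)`, so self-convergence would put the first one
-- there too, although it escapes.
bad⇒¬selfConvergent : {Z : Set z} {K : Set k} {_∈_ : REL Z K m} (β : Bad _∈_) {φ : ℕ → ℕ} →
                      Increasing φ → ¬ SelfConvergent _∈_ (Bad.point β ∘ φ)
bad⇒¬selfConvergent β {φ} inc sc =
  escapes (φ 0) (sc (closed (φ 0)) (λ N → suc N , ℕ.n≤1+n N , later (inc _ _ (s≤s z≤n))) 0)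
  where open Bad β

-- A state s stands for the set reach s of the points still allowed.
record BadProcess {Z : Set z} {K : Set k} (_∈_ : REL Z K m) (s r : Level) :
                  Set (z ⊔ k ⊔ m ⊔ lsuc (s ⊔ r)) where
  field
    State     : Set s
    reach     : State → Pred Z r
    pick      : State → Z
    code      : State → K
    next      : State → State
    pick∈     : ∀ σ → reach σ (pick σ)
    pick∉     : ∀ σ → ¬ (pick σ ∈ code σ)
    next⊆     : ∀ σ {y} → reach (next σ) y → reach σ y
    next⊆code : ∀ σ {y} → reach (next σ) y → y ∈ code σ

  module _ (start : State) where

    state : ℕ → State
    state zero    = start
    state (suc n) = next (state n)

    reach-anti : ∀ {i j} → i ℕ.≤ j → ∀ {y} → reach (state j) y → reach (state i) y
    reach-anti i≤j = go (ℕ.≤⇒≤′ i≤j)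
      where
      go : ∀ {i j} → i ℕ.≤′ j → ∀ {y} → reach (state j) y → reach (state i) y
      go ℕ.≤′-refl       = id
      go (ℕ.≤′-step i≤j) = go i≤j ∘ next⊆ _

    run : Bad _∈_
    run = record
      { point   = pick ∘ state
      ; closed  = code ∘ state
      ; escapes = pick∉ ∘ state
      -- The point picked at stage j is still reachable at stage `suc i`, and everything reachable
      -- there lies in the code chosen at stage i.
      ; later   = λ i<j → next⊆code _ (reach-anti i<j (pick∈ _))
      }

-- Strictly monotone maps between ordinals.

module _ (β γ : Ordinal ℓ) {f : ⟪ β ⟫ → ⟪ γ ⟫}
         (mono : ∀ {x y} → β [ x < y ] → γ [ f x < f y ]) where

  private
    irrefl′ : ∀ {x} → ¬ (γ [ x < x ])
    irrefl′ = IsStrictTotalOrder.irrefl (Ordinal.isStrictTotalOrder γ) refl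

  mono⇒injective : ∀ {x y} → f x ≡ f y → x ≡ y
  mono⇒injective {x} {y} eq with Ordinal.compare β x y
  ... | tri< lt _ _ = contradiction (subst (λ z → γ [ f x < z ]) (sym eq) (mono lt)) irrefl′
  ... | tri≈ _ x≡y _ = x≡y
  ... | tri> _ _ gt = contradiction (subst (λ z → γ [ f y < z ]) eq (mono gt)) irrefl′

  mono⇒reflects : ∀ {x y} → γ [ f x < f y ] → β [ x < y ]
  mono⇒reflects {x} {y} lt with Ordinal.compare β x y
  ... | tri< x<y _ _  = x<y
  ... | tri≈ _ refl _ = contradiction lt irrefl′
  ... | tri> _ _ gt   = contradiction (Ordinal.<-trans γ lt (mono gt)) irrefl′

  mono-surjective⇒iso : (∀ y → ∃[ x ] f x ≡ y) → IsIso β γ f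
  mono-surjective⇒iso surj = record
    { isOrderMonomorphism = record
      { isOrderHomomorphism = record { cong = cong f ; mono = mono }
      ; injective           = mono⇒injective
      ; cancel              = mono⇒reflects
      }
    ; surjective = λ y → proj₁ (surj y) , λ { refl → proj₂ (surj y) }
    }

surjection : {β γ : Ordinal ℓ} {f : ⟪ β ⟫ → ⟪ γ ⟫} → IsIso β γ f → ∀ y → ∃[ x ] f x ≡ y
surjection iso y = let x , eq = IsOrderIsomorphism.surjective iso y in x , eq refl

≺-image : {β γ δ : Ordinal ℓ} {f : ⟪ β ⟫ → ⟪ γ ⟫} → (∀ {x y} → β [ x < y ] → γ [ f x < f y ]) →
          (∀ y → ∃[ x ] f x ≡ y) → β ≺ δ → γ ≺ δ
≺-image {β = β} {γ} {δ} {f} mono surj (b , g , iso) =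
  b , g ∘ inv , mono-surjective⇒iso γ (δ ↓ b)
    (λ {y} {y′} lt → Iso.mono (mono⇒reflects β γ mono
      (subst (λ z → γ [ z < f (inv y′) ]) (sym (proj₂ (surj y)))
        (subst (λ z → γ [ y < z ]) (sym (proj₂ (surj y′))) lt))))
    (λ z → let x , eq = surjection {β = β} {δ ↓ b} iso z
           in f x , trans (cong g (mono⇒injective β γ mono (proj₂ (surj (f x))))) eq)
  where
  module Iso = IsOrderIsomorphism iso
  inv : ⟪ γ ⟫ → ⟪ β ⟫
  inv y = proj₁ (surj y)

-- Sets generated by a subbasis.

module _ {X : Set x} {B : Pred (Pred X q) r} where

  -- This is self-convergence in terms of open sets: one that contains some term contains almost
  -- all. An intersection takes the larger threshold; a union inherits the threshold of a member
  -- containing the term.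
  generated-eventually : {y : ℕ → X} →
    (∀ {P} → B P → ∀ n → P (y n) → Eventually (P ∘ y)) →
    ∀ {P} → Generated B P → ∀ n → P (y n) → Eventually (P ∘ y)
  generated-eventually base (basic b) n = base b n
  generated-eventually base (resp (P⊆Q , Q⊆P) g) n Qyn =
    let N , h = generated-eventually base g n (Q⊆P Qyn) in N , λ m N≤m → P⊆Q (h m N≤m)
  generated-eventually base gen-U n _ = 0 , λ _ _ → tt
  generated-eventually base (gen-∩ g g′) n (Pyn , Qyn) =
    let N  , h  = generated-eventually base g n Pyn
        N′ , h′ = generated-eventually base g′ n Qyn
    in N ℕ.⊔ N′ , λ m le → h m (ℕ.≤-trans (ℕ.m≤m⊔n N N′) le) , h′ m (ℕ.≤-trans (ℕ.m≤n⊔m N N′) le)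
  generated-eventually base (gen-⋃ I P g) n (i , Piyn) =
    let N , h = generated-eventually base (g i) n Piyn in N , λ m N≤m → i , h m N≤m

  generated-upward : {_≼_ : Rel X s} →
    (∀ {P} → B P → ∀ {y z} → y ≼ z → P y → P z) →
    ∀ {P} → Generated B P → ∀ {y z} → y ≼ z → P y → P z
  generated-upward base (basic b) y≼z Py = base b y≼z Py
  generated-upward base (resp (P⊆Q , Q⊆P) g) y≼z Qy =
    P⊆Q (generated-upward base g y≼z (Q⊆P Qy))
  generated-upward base gen-U _ _ = tt
  generated-upward base (gen-∩ g g′) y≼z (Py , Qy) =
    generated-upward base g y≼z Py , generated-upward base g′ y≼z Qy
  generated-upward base (gen-⋃ I P g) y≼z (i , Piy) = i , generated-upward base (g i) y≼z Piy

-- A closed set is coded by its open complement, so that subbasic open sets can serve directly as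
-- codes.
_∉ᵒ_ : {X : Set x} {B : Pred (Pred X q) r} → REL X (Σ[ P ∈ Pred X q ] B P) q
y ∉ᵒ (P , _) = ¬ P y

-- Tree embedding and immediate subtrees.

module _ {α : Ordinal ℓ} {A : Set ℓ} {_≼_ : Rel A r} where

  Embeds-refl : (∀ {a} → a ≼ a) → ∀ {t : Tree α A} → Embeds _≼_ t t
  Embeds-refl ≼-refl {⋆} = leaf
  Embeds-refl ≼-refl {a ⟨ word t f ⟩} =
    node ≼-refl (id , id , λ γ → Embeds-refl ≼-refl {f γ})

  Embeds-trans : (∀ {a b c} → a ≼ b → b ≼ c → a ≼ c) →
                 ∀ {s t u : Tree α A} → Embeds _≼_ s t → Embeds _≼_ t u → Embeds _≼_ s u
  Embeds-trans ≼-trans leaf _ = leaf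
  Embeds-trans ≼-trans s≤t (child γ t≤u) = child γ (Embeds-trans ≼-trans s≤t t≤u)
  Embeds-trans ≼-trans (child γ s≤t) (node _ (h , _ , t≤u)) =
    child (h γ) (Embeds-trans ≼-trans s≤t (t≤u γ))
  Embeds-trans ≼-trans (node b≼a (h , mono , s≤t)) (node a≼c (h′ , mono′ , t≤u)) =
    node (≼-trans b≼a a≼c)
         (h′ ∘ h , mono′ ∘ mono , λ γ → Embeds-trans ≼-trans (s≤t γ) (t≤u (h γ)))

module _ {α : Ordinal ℓ} {A : Set ℓ} where

  data _◁_ : Rel (Tree α A) ℓ where
    subtree : ∀ {a w} γ → letter w γ ◁ (a ⟨ w ⟩)

  ◁-wellFounded : WellFounded _◁_
  ◁-wellFounded ⋆              = acc λ ()
  ◁-wellFounded (a ⟨ word t f ⟩) = acc λ { (subtree γ) → ◁-wellFounded (f γ) }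

-- Classical arguments about sequences and minimal elements.

module _ (em : ∀ e → ExcludedMiddle e) where

  dne : {P : Set p} → ¬ ¬ P → P
  dne = decidable-stable (em _)

  ¬∀⇒∃¬ : {A : Set a} {P : Pred A p} → ¬ (∀ x → P x) → ∃[ x ] ¬ P x
  ¬∀⇒∃¬ ¬∀ = dne (λ ¬∃ → ¬∀ (λ x → dne (λ ¬Px → ¬∃ (x , ¬Px))))

  ¬infinitely⇒eventually : {P : Pred ℕ p} → ¬ Infinitely P → Eventually (¬_ ∘ P)
  ¬infinitely⇒eventually ¬inf =
    let N , ¬h = ¬∀⇒∃¬ ¬inf in N , λ n N≤n Pn → ¬h (n , N≤n , Pn)

  Infinitely-⊎ : {P : Pred ℕ p} {Q : Pred ℕ r} →
                 Infinitely (λ n → P n ⊎ Q n) → Infinitely P ⊎ Infinitely Q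
  Infinitely-⊎ {P = P} {Q = Q} inf with em _ {Infinitely P}
  ... | yes infP = inj₁ infP
  ... | no ¬infP =
    let M , ¬P = ¬infinitely⇒eventually ¬infP
    in inj₂ (Infinitely-map≥ M (λ { n le (inj₁ Pn) → contradiction Pn (¬P n le)
                                  ; n le (inj₂ Qn) → Qn }) inf)

  module _ {A : Set a} {_⊏_ : Rel A r} (wf : WellFounded _⊏_) (P : Pred A p) where

    abstract
      minimal : ∃[ x ] P x → ∃[ x ] P x × (∀ y → y ⊏ x → ¬ P y)
      minimal (x , Px) = go x (wf x) Px
        where
        go : ∀ x → Acc _⊏_ x → P x → ∃[ x ] P x × (∀ y → y ⊏ x → ¬ P y)
        go x (acc rs) Px with em _ {∃[ y ] y ⊏ x × P y}
        ... | yes (y , y⊏x , Py) = go y (rs y⊏x) Py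
        ... | no ¬∃              = x , Px , λ y y⊏x Py → ¬∃ (y , y⊏x , Py)

  module _ {Z : Set z} {K : Set k} {_∈_ : REL Z K m} where

    abstract
      -- If no subsequence is self-convergent, each has a closed set C that contains infinitely many
      -- of its terms but misses one. Picking the missed term, passing to the terms in C and
      -- repeating gives a bad sequence.
      noBad⇒selfConvergent : NoBad _∈_ → (x : ℕ → Z) →
                             ∃[ φ ] Increasing φ × SelfConvergent _∈_ (x ∘ φ)
      noBad⇒selfConvergent noBad x = dne λ none →
        let step : (σ : ∃[ φ ] Increasing φ) → ∃[ C ] ∃[ n ]
                   Infinitely (λ m → x (proj₁ σ m) ∈ C) × ¬ (x (proj₁ σ n) ∈ C)
            step (φ , inc) = dne λ no → none (φ , inc , λ C inf n →
                               dne λ ∉C → no (C , n , inf , ∉C))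
            sub = λ σ → enumerate (proj₁ (proj₂ (proj₂ (step σ)))) 0
        in noBad (BadProcess.run (record
          { State     = ∃[ φ ] Increasing φ
          ; reach     = λ σ y → ∃[ n ] x (proj₁ σ n) ≡ y
          ; pick      = λ σ → x (proj₁ σ (proj₁ (proj₂ (step σ))))
          ; code      = λ σ → proj₁ (step σ)
          ; next      = λ σ → proj₁ σ ∘ proj₁ (sub σ) , λ i j i<j → proj₂ σ _ _ (proj₁ (proj₂ (sub σ)) i j i<j)
          ; pick∈     = λ σ → _ , refl
          ; pick∉     = λ σ → proj₂ (proj₂ (proj₂ (step σ)))
          ; next⊆     = λ { σ (n , eq) → proj₁ (sub σ) n , eq }
          ; next⊆code = λ { σ (n , refl) → proj₂ (proj₂ (proj₂ (sub σ)) n) }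
          }) (id , λ _ _ → id))

    -- Nash-Williams' minimal bad sequence: a state D is the set of points allowed by
    -- the closed sets chosen so far, and the next point is ⊏-minimal among those
    -- that start a bad sequence in D.
    module _ {_⊏_ : Rel Z r} (wf : WellFounded _⊏_)
             (down : ∀ C {x y} → y ⊏ x → x ∈ C → y ∈ C) where

      private
        BadIn : Pred Z (z ⊔ k ⊔ m ⊔ r) → Set _
        BadIn D = Σ[ β ∈ Bad _∈_ ] ∀ n → D (Bad.point β n)

        Closed : Pred Z (z ⊔ k ⊔ m ⊔ r) → Set _
        Closed D = ∀ {x y} → y ⊏ x → D x → D y

        _∩_ : Pred Z (z ⊔ k ⊔ m ⊔ r) → K → Pred Z (z ⊔ k ⊔ m ⊔ r)
        (D ∩ C) y = D y × y ∈ C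

        Extends : Pred Z (z ⊔ k ⊔ m ⊔ r) → Pred Z _
        Extends D x = D x × ∃[ C ] ¬ (x ∈ C) × BadIn (D ∩ C)

        bad⇒extends : ∀ {D} (β : BadIn D) → Extends D (Bad.point (proj₁ β) 0)
        bad⇒extends (β , β⊆D) =
          β⊆D 0 , closed 0 , escapes 0 , tail 1 , λ n → β⊆D (n ℕ.+ 1) , later (ℕ.m≤n+m 1 n)
          where open Bad β

        minimals : BadProcess _∈_ _ _
        minimals = record
          { State     = Σ[ D ∈ Pred Z _ ] BadIn D × Closed D
          ; reach     = proj₁
          ; pick      = proj₁ ∘ best
          ; code      = λ σ → proj₁ (proj₂ (proj₁ (proj₂ (best σ))))
          ; next      = λ σ → let _ , (_ , C , _ , β) , _ = best σ in
                        proj₁ σ ∩ C , β ,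
                        λ y⊏x (Dx , x∈C) → proj₂ (proj₂ σ) y⊏x Dx , down C y⊏x x∈C
          ; pick∈     = λ σ → proj₁ (proj₁ (proj₂ (best σ)))
          ; pick∉     = λ σ → proj₁ (proj₂ (proj₂ (proj₁ (proj₂ (best σ)))))
          ; next⊆     = λ σ → proj₁
          ; next⊆code = λ σ → proj₂
          }
          where
          best : (σ : Σ[ D ∈ Pred Z _ ] BadIn D × Closed D) →
                 ∃[ x ] Extends (proj₁ σ) x × (∀ y → y ⊏ x → ¬ Extends (proj₁ σ) y)
          best (D , β , _) = minimal wf (Extends D) (_ , bad⇒extends {D} β)

      minimalBad : Bad _∈_ →
        Σ[ β ∈ Bad _∈_ ]
          (∀ n y → y ⊏ Bad.point β n → y ∈ Bad.closed β n) ×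
          NoBad {Z = Σ[ y ∈ Z ] ∃[ n ] y ⊏ Bad.point β n} (λ y C → proj₁ y ∈ C)
      minimalBad β₀ = run start , below∈ , noBad
        where
        open BadProcess minimals

        start : State
        start = (λ _ → ⊤) , (β₀ , λ _ → tt) , λ _ _ → tt

        σ : ℕ → State
        σ = state start

        unextendable : ∀ n y → y ⊏ pick (σ n) → ¬ Extends (proj₁ (σ n)) y
        unextendable n = proj₂ (proj₂ (minimal wf (Extends (proj₁ (σ n))) _))

        below∈ : ∀ n y → y ⊏ pick (σ n) → y ∈ code (σ n)
        -- Otherwise y could replace the point picked at stage n: it escapes the same code, and the
        -- bad sequence carried by `σ (suc n)` would continue it.
        below∈ n y y⊏x = dne λ y∉C → unextendable n y y⊏x
          (proj₂ (proj₂ (σ n)) y⊏x (pick∈ (σ n)) , code (σ n) , y∉C ,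
           proj₁ (proj₂ (σ (suc n))))

        noBad : NoBad {Z = Σ[ y ∈ Z ] ∃[ n ] y ⊏ pick (σ n)} (λ y C → proj₁ y ∈ C)
        -- Each term lies below some picked point; y is a term whose index N is least. The terms
        -- from y on then lie in the set allowed at stage N, so y starts a bad sequence there,
        -- against the minimality of the point picked.
        noBad β = unextendable N y (subst (λ n → y ⊏ pick (σ n)) eq (proj₂ (proj₂ (point i₀))))
          (in-D 0 , closed i₀ , escapes i₀ ,
           record
             { point   = λ n → proj₁ (point (suc n ℕ.+ i₀))
             ; closed  = λ n → closed (suc n ℕ.+ i₀)
             ; escapes = λ n → escapes (suc n ℕ.+ i₀)
             ; later   = λ i<j → later (ℕ.+-monoˡ-< i₀ (s≤s i<j))
             } ,
           λ n → in-D (suc n) , later (s≤s (ℕ.m≤n+m i₀ n)))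
          where
          open Bad β

          index : ℕ → ℕ
          index i = proj₁ (proj₂ (point i))

          least : ∃[ N ] (∃[ i ] index i ≡ N) × (∀ n → n ℕ.< N → ¬ (∃[ i ] index i ≡ n))
          least = minimal ℕ.<-wellFounded (λ n → ∃[ i ] index i ≡ n) (index 0 , 0 , refl)

          N i₀ : ℕ
          N  = proj₁ least
          i₀ = proj₁ (proj₁ (proj₂ least))

          y : Z
          y = proj₁ (point i₀)

          eq : index i₀ ≡ N
          eq = proj₂ (proj₁ (proj₂ least))

          in-D : ∀ n → proj₁ (σ N) (proj₁ (point (n ℕ.+ i₀)))
          in-D n = let x , i , x⊏ = point (n ℕ.+ i₀) in
            reach-anti start (ℕ.≮⇒≥ (λ lt → proj₂ (proj₂ least) i lt (n ℕ.+ i₀ , refl)))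
              (proj₂ (proj₂ (σ i)) x⊏ (pick∈ (σ i)))

  -- Noetherian spaces and bad sequences.

  module _ {X : Set x} {B : Pred (Pred X q) r} {Y : Set z} (f : Y → X) where

    -- An analogue of Alexander's subbase lemma: self-convergence only has to be
    -- tested on a subbasis.
    generated-noBad : NoBad (λ y (P : Σ[ P ∈ Pred X q ] B P) → f y ∉ᵒ P) →
                      NoBad (λ y (P : Σ[ P ∈ Pred X q ] Generated B P) → f y ∉ᵒ P)
    generated-noBad noBad β =
      let φ , φ-inc , sc = noBad⇒selfConvergent noBad point
          N , h = generated-eventually {y = f ∘ point ∘ φ}
                    (λ {P} BP n Py → let M , h = ¬infinitely⇒eventually λ inf →
                                           sc (P , BP) inf n Py
                                     in M , λ m M≤m → dne (h m M≤m))
                    (proj₂ (closed (φ 0))) 0 (dne (escapes (φ 0)))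
      in later (φ-inc 0 (suc N) (s≤s z≤n)) (h (suc N) (ℕ.n≤1+n N))
      where open Bad β

  module _ {X : Set x} (τ : Topology X q) where

    -- The complements of the closed sets of a bad sequence cover their union. A finite subcover has
    -- all its indices below some N, yet `point N` lies in the N-th complement and in no earlier
    -- one.
    noetherian⇒noBad : Noetherian τ → NoBad (λ y (P : Σ[ P ∈ Pred X q ] P ∈ Open τ) → y ∉ᵒ P)
    noetherian⇒noBad noeth β =
      let is , covers = noeth (λ y → ∃[ n ] opens n y) (Lift q ℕ) (opens ∘ lower)
                          (λ (lift n) → proj₂ (closed n)) (λ (n , Pny) → lift n , Pny)
          N = suc (max 0 (map lower is))
      in impossible N is
           (All.map⁻ (All.map s≤s (xs≤max 0 (map lower is))))
           (covers (N , dne (escapes N)))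
      where
      open Bad β

      opens : ℕ → Pred X q
      opens n = proj₁ (closed n)

      impossible : ∀ N (is : List (Lift q ℕ)) → All (λ i → lower i ℕ.< N) is →
                   ¬ Any (λ i → opens (lower i) (point N)) is
      impossible N (i ∷ is) (i<N ∷ _) (here Py) = later i<N Py
      impossible N (_ ∷ is) (_ ∷ is<N) (there any) = impossible N is is<N any

    -- Without a finite subcover, every finite list of indices leaves a point of S uncovered. Adding
    -- an index whose set contains that point and repeating gives a bad sequence.
    noBad⇒noetherian : NoBad (λ y (P : Σ[ P ∈ Pred X q ] P ∈ Open τ) → y ∉ᵒ P) → Noetherian τ
    noBad⇒noetherian noBad S I P P-open S⊆⋃P = dne λ none →
      let uncovered : ∀ is → ∃[ y ] S y × ¬ Any (λ i → P i y) is
          uncovered is = dne λ no → none (is , λ {y} Sy → dne λ ¬any → no (y , Sy , ¬any))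
          index = λ is → proj₁ (S⊆⋃P (proj₁ (proj₂ (uncovered is))))
      in noBad (BadProcess.run (record
        { State     = List I
        ; reach     = λ is y → S y × ¬ Any (λ i → P i y) is
        ; pick      = λ is → proj₁ (uncovered is)
        ; code      = λ is → P (index is) , P-open (index is)
        ; next      = λ is → index is ∷ is
        ; pick∈     = λ is → proj₂ (uncovered is)
        ; pick∉     = λ is ∉ → ∉ (proj₂ (S⊆⋃P (proj₁ (proj₂ (uncovered is)))))
        ; next⊆     = λ is (Sy , ¬any) → Sy , ¬any ∘ there
        ; next⊆code = λ is (_ , ¬any) → ¬any ∘ here
        }) [])

  -- Order types of intervals

  -- The bound is stored irrelevantly; excluded middle decides it, so it can be recomputed.
  bound : (β : Ordinal ℓ) → ∀ {t} (γ : ⟪ β ↓ t ⟫) → β [ value γ < t ]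
  bound β (x , [ x<t ]) = recompute (em _) x<t

  module _ (α : Ordinal ℓ) where

    open Ordinal α using (compare)
      renaming (_<_ to _⋖_; <-trans to ⋖-trans; <-wellFounded to ⋖-wellFounded)
    open IsStrictTotalOrder (Ordinal.isStrictTotalOrder α) using (irrefl)

    infix 4 _⊴_
    _⊴_ : Rel ⟪ α ⟫ ℓ
    x ⊴ y = ¬ (y ⋖ x)

    ⊴-refl : ∀ {x} → x ⊴ x
    ⊴-refl = irrefl refl

    ⊴-reflexive : ∀ {x y} → x ≡ y → x ⊴ y
    ⊴-reflexive refl = ⊴-refl

    ⋖⇒⊴ : ∀ {x y} → x ⋖ y → x ⊴ y
    ⋖⇒⊴ x⋖y y⋖x = irrefl refl (⋖-trans x⋖y y⋖x)

    ⊴-⋖-trans : ∀ {x y z} → x ⊴ y → y ⋖ z → x ⋖ z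
    ⊴-⋖-trans {x} {y} x⊴y y⋖z with compare x y
    ... | tri< x⋖y _ _  = ⋖-trans x⋖y y⋖z
    ... | tri≈ _ refl _ = y⋖z
    ... | tri> _ _ y⋖x  = contradiction y⋖x x⊴y

    ⋖-⊴-trans : ∀ {x y z} → x ⋖ y → y ⊴ z → x ⋖ z
    ⋖-⊴-trans {x} {y} {z} x⋖y y⊴z with compare y z
    ... | tri< y⋖z _ _  = ⋖-trans x⋖y y⋖z
    ... | tri≈ _ refl _ = x⋖y
    ... | tri> _ _ z⋖y  = contradiction z⋖y y⊴z

    ⊴-trans : ∀ {x y z} → x ⊴ y → y ⊴ z → x ⊴ z
    ⊴-trans x⊴y y⊴z z⋖x = y⊴z (⋖-⊴-trans z⋖x x⊴y)

    ⊴-antisym : ∀ {x y} → x ⊴ y → y ⊴ x → x ≡ y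
    ⊴-antisym {x} {y} x⊴y y⊴x with compare x y
    ... | tri< x⋖y _ _ = contradiction x⋖y y⊴x
    ... | tri≈ _ x≡y _ = x≡y
    ... | tri> _ _ y⋖x = contradiction y⋖x x⊴y

    ⋖-or-⊵ : ∀ x y → x ⋖ y ⊎ y ⊴ x
    ⋖-or-⊵ x y with compare x y
    ... | tri< x⋖y _ _ = inj₁ x⋖y
    ... | tri≈ x⋖̸y _ _ = inj₂ x⋖̸y
    ... | tri> x⋖̸y _ _ = inj₂ x⋖̸y

    least : (P : Pred ⟪ α ⟫ p) → ∃[ x ] P x → ∃[ x ] P x × (∀ y → P y → x ⊴ y)
    least P ∃P = let x , Px , min = minimal ⋖-wellFounded P ∃P
                 in x , Px , λ y Py y⋖x → min y y⋖x Py

    private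
      -- Recursion on d: the least element strictly above the lengths of all [c , x) with x before
      -- d. The accompanying bound by d shows that d itself is a candidate, so the minimum exists
      -- inside α.
      lenAcc : ∀ c d → Acc _⋖_ d → ∃[ y ] y ⊴ d
      lenAcc-least : ∀ c d (rs : ∀ {x} → x ⋖ d → Acc _⋖_ x) →
        let Upper = λ y → ∀ x → c ⊴ x → (x⋖d : x ⋖ d) → proj₁ (lenAcc c x (rs x⋖d)) ⋖ y
        in ∃[ y ] Upper y × (∀ z → Upper z → y ⊴ z)
      lenAcc c d (acc rs) =
        let y , _ , min = lenAcc-least c d rs
        in y , min d λ x _ x⋖d → ⊴-⋖-trans (proj₂ (lenAcc c x (rs x⋖d))) x⋖d
      lenAcc-least c d rs = least _ (d , λ x _ x⋖d → ⊴-⋖-trans (proj₂ (lenAcc c x (rs x⋖d))) x⋖d)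

      lenAcc-irrelevant : ∀ c d (p q : Acc _⋖_ d) → proj₁ (lenAcc c d p) ⊴ proj₁ (lenAcc c d q)
      lenAcc-irrelevant c d (acc rs) (acc rs′) =
        proj₂ (proj₂ (lenAcc-least c d rs)) _ λ x c⊴x x⋖d →
          ⊴-⋖-trans (lenAcc-irrelevant c x (rs x⋖d) (rs′ x⋖d))
                    (proj₁ (proj₂ (lenAcc-least c d rs′)) x c⊴x x⋖d)

    abstract
      -- The order type of the interval [c , d), as an element of α.
      len : ⟪ α ⟫ → ⟪ α ⟫ → ⟪ α ⟫
      len c d = proj₁ (lenAcc c d (⋖-wellFounded d))

      len-mono-⋖ : ∀ {c x d} → c ⊴ x → x ⋖ d → len c x ⋖ len c d
      len-mono-⋖ {c} {x} {d} c⊴x x⋖d with ⋖-wellFounded d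
      ... | acc rs = ⊴-⋖-trans (lenAcc-irrelevant c x (⋖-wellFounded x) (rs x⋖d))
                               (proj₁ (proj₂ (lenAcc-least c d rs)) x c⊴x x⋖d)

      -- With `len-mono-⋖` this characterises `len c d` as a least strict upper bound; as `len` is
      -- abstract, all later facts rest on these two.
      len-least : ∀ {c d y} → (∀ x → c ⊴ x → x ⋖ d → len c x ⋖ y) → len c d ⊴ y
      len-least {c} {d} upper with ⋖-wellFounded d
      ... | acc rs = proj₂ (proj₂ (lenAcc-least c d rs)) _ λ x c⊴x x⋖d →
                       ⊴-⋖-trans (lenAcc-irrelevant c x (rs x⋖d) (⋖-wellFounded x)) (upper x c⊴x x⋖d)

    len-mono : ∀ {c x d} → c ⊴ x → x ⊴ d → len c x ⊴ len c d
    len-mono {c} {x} {d} c⊴x x⊴d with compare x d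
    ... | tri< x⋖d _ _  = ⋖⇒⊴ (len-mono-⋖ c⊴x x⋖d)
    ... | tri≈ _ refl _ = ⊴-refl
    ... | tri> _ _ d⋖x  = contradiction d⋖x x⊴d

    len-empty : ∀ {c y} → len c c ⊴ y
    len-empty = len-least λ x c⊴x x⋖c → contradiction x⋖c c⊴x

    len-reflects-⋖ : ∀ {c x y} → c ⊴ y → len c x ⋖ len c y → x ⋖ y
    len-reflects-⋖ {c} {x} {y} c⊴y lt with ⋖-or-⊵ x y
    ... | inj₁ x⋖y = x⋖y
    ... | inj₂ y⊴x = contradiction lt (len-mono c⊴y y⊴x)

    -- By induction on x, `len c x` is at most `len c′` of the image of x; the images stay below d′.
    len-embed : ∀ {c d c′ d′} (h : ∀ x → c ⊴ x → x ⋖ d → ⟪ α ⟫) →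
                (∀ x p q → c′ ⊴ h x p q × h x p q ⋖ d′) →
                (∀ x p q x′ p′ q′ → x ⋖ x′ → h x p q ⋖ h x′ p′ q′) →
                len c d ⊴ len c′ d′
    len-embed {c} {d} {c′} {d′} h into mono = len-least λ x p q →
      ⊴-⋖-trans (go x (⋖-wellFounded x) p q)
                (len-mono-⋖ (proj₁ (into x p q)) (proj₂ (into x p q)))
      where
      go : ∀ x → Acc _⋖_ x → ∀ p q → len c x ⊴ len c′ (h x p q)
      go x (acc rs) p q = len-least λ y c⊴y y⋖x →
        let y⋖d = ⋖-trans y⋖x q in
        ⊴-⋖-trans (go y (rs y⋖x) c⊴y y⋖d)
                  (len-mono-⋖ (proj₁ (into y c⊴y y⋖d)) (mono y c⊴y y⋖d x p q y⋖x))

    len-anti : ∀ {c c′ d} → c ⊴ c′ → len c′ d ⊴ len c d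
    len-anti c⊴c′ = len-embed (λ x _ _ → x) (λ x c′⊴x x⋖d → ⊴-trans c⊴c′ c′⊴x , x⋖d)
                              (λ _ _ _ _ _ _ → id)

    -- Some x has `y ⊴ len c x`, since otherwise y would bound `len c d`. If the inequality is
    -- strict, descend from d to x.
    len-surjective : ∀ {c d y} → y ⋖ len c d → ∃[ x ] c ⊴ x × x ⋖ d × len c x ≡ y
    len-surjective {c} {d} {y} = go d (⋖-wellFounded d)
      where
      go : ∀ d → Acc _⋖_ d → y ⋖ len c d → ∃[ x ] c ⊴ x × x ⋖ d × len c x ≡ y
      go d (acc rs) y⋖len with em _ {∃[ x ] c ⊴ x × x ⋖ d × y ⊴ len c x}
      ... | no ¬∃ = contradiction y⋖len (len-least λ x c⊴x x⋖d →
                      dne λ ¬lt → ¬∃ (x , c⊴x , x⋖d , ¬lt))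
      ... | yes (x , c⊴x , x⋖d , y⊴len) with compare y (len c x)
      ...   | tri≈ _ eq _ = x , c⊴x , x⋖d , sym eq
      ...   | tri> _ _ gt = contradiction gt y⊴len
      ...   | tri< lt _ _ = let x′ , c⊴x′ , x′⋖x , eq = go x (rs x⋖d) lt
                            in x′ , c⊴x′ , ⋖-trans x′⋖x x⋖d , eq

    -- Left subtraction of ordinals: `len c` maps [d , e) isomorphically onto [len c d , len c e),
    -- and the two directions give the two inequalities.
    len-len : ∀ {c d e} → c ⊴ d → d ⊴ e → len (len c d) (len c e) ≡ len d e
    len-len {c} {d} {e} c⊴d d⊴e = ⊴-antisym
      (len-embed (λ y _ y⋖ → proj₁ (len-surjective y⋖))
        (λ y d⊴y y⋖ → let x , c⊴x , x⋖e , eq = len-surjective y⋖ in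
           (λ x⋖d → d⊴y (subst (_⋖ _) eq (len-mono-⋖ c⊴x x⋖d))) , x⋖e)
        (λ y _ q y′ _ q′ y⋖y′ →
           let x  , _    , _ , eq  = len-surjective q
               x′ , c⊴x′ , _ , eq′ = len-surjective q′
           in len-reflects-⋖ c⊴x′ (subst (_⋖ _) (sym eq) (subst (_ ⋖_) (sym eq′) y⋖y′))))
      (len-embed (λ x _ _ → len c x)
        (λ x d⊴x x⋖e → len-mono c⊴d d⊴x , len-mono-⋖ (⊴-trans c⊴d d⊴x) x⋖e)
        (λ x d⊴x _ x′ _ _ x⋖x′ → len-mono-⋖ (⊴-trans c⊴d d⊴x) x⋖x′))

    -- Length bounds are kept as downward closed subsets of α: a bound β need not be an element of
    -- α, and cutting a factor produces further conditions of this kind.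
    record DownSet : Set (lsuc ℓ) where
      field
        holds : Pred ⟪ α ⟫ ℓ
        down  : ∀ {x y} → y ⊴ x → holds x → holds y

    open DownSet

    -- The least point, say the n-th, is at most its successor in the sequence, which lies in
    -- `closed n`.
    downSets-noBad : NoBad (λ x B → holds B x)
    downSets-noBad β =
      let y , (n , eq) , min = least (λ y → ∃[ n ] point n ≡ y) (point 0 , 0 , refl)
      in escapes n (down (closed n) (subst (_⊴ point (suc n)) (sym eq) (min (point (suc n)) (suc n , refl)))
                                    (later ℕ.≤-refl))
      where open Bad β

    -- A set that omits the least element omitted by any of them is contained in all the others.
    downSets-least : (D : ℕ → DownSet) → ∃[ N ] ∀ n {y} → holds (D N) y → holds (D n) y
    downSets-least D with em _ {∃[ y ] ∃[ n ] ¬ holds (D n) y}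
    ... | no ¬∃ = 0 , λ n {y} _ → dne λ ∉ → ¬∃ (y , n , ∉)
    ... | yes ∃y =
      let y₀ , (N , ∉) , min = least _ ∃y
      in N , λ n {y} ∈N → dne λ ∉n → ∉ (down (D N) (min y (n , ∉n)) ∈N)

    -- Products of closed sets of words

    module _ {X : Set x} {K : Set k} (_∈_ : REL X K m) where

      Atom : Set (lsuc ℓ ⊔ k)
      Atom = K × DownSet

      AllIn : Word α X → K → ⟪ α ⟫ → ⟪ α ⟫ → Set (ℓ ⊔ m)
      AllIn w C c d = ∀ γ → c ⊴ value γ → value γ ⋖ d → letter w γ ∈ C

      -- The word w restricted to [c , d) lies in a product of atoms, expressed
      -- with cut points inside w instead of a concatenation of words.
      data Factors (w : Word α X) : List Atom → ⟪ α ⟫ → ⟪ α ⟫ → Set (lsuc ℓ ⊔ k ⊔ m) where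
        []  : ∀ {c} → Factors w [] c c
        cut : ∀ {C B Fs c d} e → c ⊴ e → AllIn w C c e → holds B (len c e) →
              Factors w Fs e d → Factors w ((C , B) ∷ Fs) c d

      AllIn-empty : ∀ {w C c} → AllIn w C c c
      AllIn-empty γ c⊴γ γ⋖c = contradiction γ⋖c c⊴γ

      factors-⊴ : ∀ {w Fs c d} → Factors w Fs c d → c ⊴ d
      factors-⊴ []                  = ⊴-refl
      factors-⊴ (cut e c⊴e _ _ fs) = ⊴-trans c⊴e (factors-⊴ fs)

      factors-++⁺ : ∀ {w Fs Gs c d e} → Factors w Fs c d → Factors w Gs d e → Factors w (Fs ++ Gs) c e
      factors-++⁺ []                     gs = gs
      factors-++⁺ (cut x c⊴x all len fs) gs = cut x c⊴x all len (factors-++⁺ fs gs)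

      factors-++⁻ : ∀ {w} Fs {Gs c e} → Factors w (Fs ++ Gs) c e →
                    ∃[ d ] Factors w Fs c d × Factors w Gs d e
      factors-++⁻ []       gs                     = _ , [] , gs
      factors-++⁻ (_ ∷ Fs) (cut x c⊴x all len hs) =
        let d , fs , gs = factors-++⁻ Fs hs in d , cut x c⊴x all len fs , gs

      cut-empty : ∀ {w C B Fs c d y} → holds B y → Factors w Fs c d → Factors w ((C , B) ∷ Fs) c d
      cut-empty {B = B} By fs = cut _ ⊴-refl AllIn-empty (down B len-empty By) fs

      -- On an empty interval all cuts are trivial, so only the inhabitation of the length
      -- conditions matters, and this does not depend on the word.
      factors-empty : ∀ {w w′ Fs d d′} → Factors w Fs d d → Factors w′ Fs d′ d′
      factors-empty []                      = []
      factors-empty (cut e d⊴e all len fs) with ⊴-antisym d⊴e (factors-⊴ fs)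
      ... | refl = cut-empty len (factors-empty fs)

      -- Products are closed under subwords: cut v at the first position sent to e′ or beyond. This
      -- serves both for prefixes and for the Higman ordering.
      factors-embed : ∀ {v w} (h : ⟪ ∣ v ∣ ⟫ → ⟪ ∣ w ∣ ⟫) →
        (∀ {γ δ} → value γ ⋖ value δ → value (h γ) ⋖ value (h δ)) →
        (∀ C γ → letter w (h γ) ∈ C → letter v γ ∈ C) →
        ∀ {Fs c d c′ d′} → c ⊴ d → d ⊴ top v →
        (∀ γ → c ⊴ value γ → value γ ⋖ d → c′ ⊴ value (h γ) × value (h γ) ⋖ d′) →
        Factors w Fs c′ d′ → Factors v Fs c d
      factors-embed {v} {w} h mono back {c = c} {d} {c′} c⊴d d⊴top into [] with compare c d
      ... | tri< c⋖d _ _ =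
            let c′⊴h , h⋖c′ = into (c , [ ⋖-⊴-trans c⋖d d⊴top ]) ⊴-refl c⋖d
            in contradiction h⋖c′ c′⊴h
      ... | tri≈ _ refl _ = []
      ... | tri> _ _ d⋖c  = contradiction d⋖c c⊴d
      factors-embed {v} {w} h mono back {c = c} {d} {c′} {d′} c⊴d d⊴top into
                    (cut {C} {B} e′ c′⊴e′ all′ len′ fs) =
        cut e c⊴e
          (λ γ c⊴γ γ⋖e → back C γ (all′ (h γ) (proj₁ (into γ c⊴γ (⋖-⊴-trans γ⋖e e⊴d)))
                                              (below γ c⊴γ γ⋖e)))
          (down B (len-embed (λ x _ x⋖e → value (h (at x x⋖e)))
                             (λ x c⊴x x⋖e → proj₁ (into _ c⊴x (⋖-⊴-trans x⋖e e⊴d)) ,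
                                            below (at x x⋖e) c⊴x x⋖e)
                             (λ _ _ _ _ _ _ → mono))
                  len′)
          (factors-embed h mono back e⊴d d⊴top
            (λ γ e⊴γ γ⋖d → above γ e⊴γ γ⋖d , proj₂ (into γ (⊴-trans c⊴e e⊴γ) γ⋖d)) fs)
        where
        -- Including d gives a cut point even when no position of the interval is sent past e′.
        After : Pred ⟪ α ⟫ ℓ
        After x = c ⊴ x × (x ≡ d ⊎ ∃[ γ ] value γ ≡ x × e′ ⊴ value (h γ))

        split : ∃[ x ] After x × (∀ y → After y → x ⊴ y)
        split = least After (d , c⊴d , inj₁ refl)

        e : ⟪ α ⟫
        e = proj₁ split

        c⊴e : c ⊴ e
        c⊴e = proj₁ (proj₁ (proj₂ split))

        e⊴d : e ⊴ d
        e⊴d = proj₂ (proj₂ split) d (c⊴d , inj₁ refl)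

        at : ∀ x → x ⋖ e → ⟪ ∣ v ∣ ⟫
        at x x⋖e = x , [ ⋖-⊴-trans (⋖-⊴-trans x⋖e e⊴d) d⊴top ]

        below : ∀ γ → c ⊴ value γ → value γ ⋖ e → value (h γ) ⋖ e′
        below γ c⊴γ γ⋖e = dne λ e′⊴hγ →
          proj₂ (proj₂ split) (value γ) (c⊴γ , inj₂ (γ , refl , e′⊴hγ)) γ⋖e

        above : ∀ γ → e ⊴ value γ → value γ ⋖ d → e′ ⊴ value (h γ)
        above γ e⊴γ γ⋖d with proj₂ (proj₁ (proj₂ split))
        ... | inj₁ e≡d = contradiction (subst (_ ⋖_) (sym e≡d) γ⋖d) e⊴γ
        ... | inj₂ (δ , δ≡e , e′⊴hδ) with compare (value δ) (value γ)
        ...   | tri< δ⋖γ _ _  = ⊴-trans e′⊴hδ (⋖⇒⊴ (mono δ⋖γ))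
        ...   | tri≈ _ refl _ = e′⊴hδ
        ...   | tri> _ _ γ⋖δ  = contradiction (subst (_ ⋖_) δ≡e γ⋖δ) e⊴γ

      factors-prefix : ∀ {w Fs c d e} → c ⊴ e → e ⊴ d → d ⊴ top w →
                       Factors w Fs c d → Factors w Fs c e
      factors-prefix c⊴e e⊴d d⊴top =
        factors-embed id id (λ _ _ → id) c⊴e (⊴-trans e⊴d d⊴top)
          λ γ c⊴γ γ⋖e → c⊴γ , ⋖-⊴-trans γ⋖e e⊴d

      -- Concatenation of self-convergent sequences of words.

      module _ (w : ℕ → Word α X) (a b d : ℕ → ⟪ α ⟫) (b⊴d : ∀ n → b n ⊴ d n)
        (sc₁ : SelfConvergent (λ n Fs → Factors (w n) Fs (a n) (b n)) id)
        (sc₂ : SelfConvergent (λ n Fs → Factors (w n) Fs (b n) (d n)) id)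
        where

        private
          Straddles : List Atom → Atom → List Atom → ℕ → Set _
          Straddles Gs (C , B) Fs n =
            ∃[ c ] ∃[ e ] c ⊴ b n × b n ⊴ e × Factors (w n) Gs (a n) c ×
              AllIn (w n) C c e × holds B (len c e) × Factors (w n) Fs e (d n)

          -- The length of the part of the straddling factor before the cut can be
          -- assumed nondecreasing along a subsequence, with values g; then the sets
          -- of admissible lengths after the cut are eventually constant.
          module Straddle Gs C B Fs (inf : Infinitely (Straddles Gs (C , B) Fs)) where

            χ = enumerate inf 0

            strad : ∀ n → Straddles Gs (C , B) Fs (proj₁ χ n)
            strad n = proj₂ (proj₂ (proj₂ χ) n)

            lengths = noBad⇒selfConvergent downSets-noBad
                        (λ n → len (proj₁ (strad n)) (b (proj₁ χ n)))

            ψ κ : ℕ → ℕ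
            ψ = proj₁ lengths
            κ = proj₁ χ ∘ ψ

            κ-increasing : Increasing κ
            κ-increasing i j i<j = proj₁ (proj₂ χ) _ _ (proj₁ (proj₂ lengths) i j i<j)

            g : ℕ → ⟪ α ⟫
            g n = len (proj₁ (strad (ψ n))) (b (κ n))

            g-selfConvergent : SelfConvergent (λ x B → holds B x) g
            g-selfConvergent = proj₂ (proj₂ lengths)

            -- Being below `g n` is a downward closed condition; if it held infinitely often,
            -- self-convergence would give `g n ⋖ g n`.
            g-eventually-⊵ : ∀ n → Eventually (λ m → g n ⊴ g m)
            g-eventually-⊵ n = ¬infinitely⇒eventually λ inf →
              ⊴-refl (g-selfConvergent (record { holds = _⋖ g n ; down = ⊴-⋖-trans }) inf n)

            Γ : DownSet
            Γ = record { holds = λ y → ∃[ n ] y ⊴ g n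
                       ; down  = λ y⊴x (n , x⊴g) → n , ⊴-trans y⊴x x⊴g }

            -- `len x t` is the remainder of t after x, so these are the lengths that fit behind x
            -- in a factor whose length satisfies B.
            After : ⟪ α ⟫ → DownSet
            After x = record { holds = λ y → ∃[ t ] holds B t × x ⊴ t × y ⊴ len x t
                             ; down  = λ y⊴y′ (t , Bt , x⊴t , y′⊴) → t , Bt , x⊴t , ⊴-trans y⊴y′ y′⊴ }

            stable : ∃[ N ] ∀ n {y} → holds (After (g N)) y → holds (After (g n)) y
            stable = downSets-least (After ∘ g)

            N : ℕ
            N = proj₁ stable

            before : ∀ n → Factors (w n) (Gs ∷ʳ (C , Γ)) (a n) (b n)
            before = sc₁ _ (Infinitely-reindex κ-increasing λ M → M , ℕ.≤-refl ,
              (let c , e , c⊴b , b⊴e , gs , all , _ = strad (ψ M) in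
               factors-++⁺ gs (cut _ c⊴b (λ γ c⊴γ γ⋖b → all γ c⊴γ (⋖-⊴-trans γ⋖b b⊴e))
                                   (M , ⊴-refl) [])))

            after : ∀ n → Factors (w n) ((C , After (g N)) ∷ Fs) (b n) (d n)
            after = sc₂ _ (Infinitely-reindex κ-increasing (Eventually⇒Infinitely
              -- From M on, `g n` is at least `g N`. The length of [b , e) is the remainder of
              -- `len c e` after `g n`, hence at most its remainder after `g N`.
              (let M , g⊴ = g-eventually-⊵ N in M , λ n M≤n →
               let c , e , c⊴b , b⊴e , gs , all , B∋ , fs = strad (ψ n) in
               cut e b⊴e (λ γ b⊴γ γ⋖e → all γ (⊴-trans c⊴b b⊴γ) γ⋖e)
                 (len c e , B∋ , ⊴-trans (g⊴ n M≤n) (len-mono c⊴b b⊴e) ,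
                  ⊴-trans (⊴-reflexive (sym (len-len c⊴b b⊴e))) (len-anti (g⊴ n M≤n))) fs)))

            whole : ∀ n → Factors (w n) (Gs ++ (C , B) ∷ Fs) (a n) (d n)
            whole n = let _ , gs , gs′ = factors-++⁻ Gs (before n) in join gs gs′ (after n)
              where
              join : ∀ {c} → Factors (w n) Gs (a n) c → Factors (w n) ((C , Γ) ∷ []) c (b n) →
                     Factors (w n) ((C , After (g N)) ∷ Fs) (b n) (d n) →
                     Factors (w n) (Gs ++ (C , B) ∷ Fs) (a n) (d n)
              -- The front length is at most `g i`, and by the choice of N the back length is also
              -- admissible after `g i`. So the joined length is at most some t satisfying B.
              join gs (cut x c⊴x all₁ (i , len⊴g) []) (cut e x⊴e all₂ ∈N fs) =
                let t , Bt , g⊴t , len⊴ = proj₂ stable i ∈N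
                in factors-++⁺ gs (cut e (⊴-trans c⊴x x⊴e)
                     (λ γ c⊴γ γ⋖e → case ⋖-or-⊵ (value γ) (b n) of λ
                       { (inj₁ γ⋖x) → all₁ γ c⊴γ γ⋖x
                       ; (inj₂ x⊴γ) → all₂ γ x⊴γ γ⋖e })
                     (down B (λ t⋖len → len⊴ (⊴-⋖-trans (len-anti len⊴g)
                               (⋖-⊴-trans (len-mono-⋖ (⊴-trans len⊴g g⊴t) t⋖len)
                                          (⊴-reflexive (len-len c⊴x x⊴e))))) Bt)
                     fs)

          -- `Gs` collects the factors ending at or before `b n`. Infinitely often the next factor
          -- also ends there and joins `Gs`, or infinitely often it straddles `b n`.
          go : ∀ Gs Fs →
            Infinitely (λ n → ∃[ c ] c ⊴ b n × Factors (w n) Gs (a n) c × Factors (w n) Fs c (d n)) →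
            ∀ n → Factors (w n) (Gs ++ Fs) (a n) (d n)
          go Gs [] inf n =
            factors-++⁺ (sc₁ Gs (Infinitely-map (λ n h → proj₁ (end n h)) inf) n)
                        (sc₂ [] (Infinitely-map (λ n h → proj₂ (end n h)) inf) n)
            where
            end : ∀ n → ∃[ c ] c ⊴ b n × Factors (w n) Gs (a n) c × Factors (w n) [] c (d n) →
                  Factors (w n) Gs (a n) (b n) × Factors (w n) [] (b n) (d n)
            end n (c , c⊴b , gs , []) with ⊴-antisym c⊴b (b⊴d n)
            ... | eq = subst (Factors (w n) Gs (a n)) eq gs ,
                       subst (λ c → Factors (w n) [] c (d n)) eq []
          go Gs ((C , B) ∷ Fs) inf n with Infinitely-⊎ (Infinitely-map step inf)
            where
            step : ∀ n → ∃[ c ] c ⊴ b n × Factors (w n) Gs (a n) c ×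
                           Factors (w n) ((C , B) ∷ Fs) c (d n) →
                   (∃[ c ] c ⊴ b n × Factors (w n) (Gs ∷ʳ (C , B)) (a n) c × Factors (w n) Fs c (d n)) ⊎
                   Straddles Gs (C , B) Fs n
            step n (c , c⊴b , gs , cut e c⊴e all B∋ fs) with ⋖-or-⊵ (b n) e
            ... | inj₁ b⋖e = inj₂ (c , e , c⊴b , ⋖⇒⊴ b⋖e , gs , all , B∋ , fs)
            ... | inj₂ e⊴b = inj₁ (e , e⊴b , factors-++⁺ gs (cut e c⊴e all B∋ []) , fs)
          ... | inj₁ inf′ = subst (λ Hs → Factors (w n) Hs (a n) (d n)) (∷ʳ-++ Gs (C , B) Fs)
                                  (go (Gs ∷ʳ (C , B)) Fs inf′ n)
          ... | inj₂ inf′ = Straddle.whole Gs C B Fs inf′ n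

        concat-selfConvergent : (∀ n → a n ⊴ b n) →
                                SelfConvergent (λ n Fs → Factors (w n) Fs (a n) (d n)) id
        concat-selfConvergent a⊴b Fs inf =
          go [] Fs (Infinitely-map (λ n fs → a n , a⊴b n , [] , fs) inf)

      -- Recurrent tails and words over a Noetherian space.

      -- By len-anti the inequality is an equality: all nonempty tails of [c , d) have
      -- the same length and the same closure.
      Recurrent : Word α X → ⟪ α ⟫ → ⟪ α ⟫ → Set (ℓ ⊔ k ⊔ m)
      Recurrent w c d = ∀ x → c ⊴ x → x ⋖ d →
        len c d ⊴ len x d × (∀ C → AllIn w C x d → AllIn w C c d)

      -- A factor ending before d can be made empty. The one reaching d can be stretched back to c,
      -- since the tail at its start has the same length and closure as the whole.
      recurrent-extend : ∀ {w Fs c d x} → Recurrent w c d → c ⊴ x → x ⋖ d →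
                         Factors w Fs x d → Factors w Fs c d
      recurrent-extend rec c⊴x x⋖d [] = contradiction x⋖d ⊴-refl
      recurrent-extend {d = d} rec c⊴x x⋖d (cut {C} {B} e x⊴e all B∋ fs) with compare e d
      ... | tri< e⋖d _ _ = cut-empty B∋ (recurrent-extend rec (⊴-trans c⊴x x⊴e) e⋖d fs)
      ... | tri≈ _ refl _ =
            let len⊴ , back = rec _ c⊴x x⋖d
            in cut e (⊴-trans c⊴x x⊴e) (back C all) (down B len⊴ B∋) fs
      ... | tri> _ _ d⋖e = contradiction d⋖e (factors-⊴ fs)

      -- Words are handled as intervals of a base word, so prefixes and tails keep their positions.
      record Piece : Set (ℓ ⊔ x) where
        constructor piece
        field
          base    : Word α X
          from    : ⟪ α ⟫
          to      : ⟪ α ⟫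
          from⊴to : from ⊴ to
          to⊴top  : to ⊴ top base

      open Piece

      _∈ᶠ_ : REL Piece (List Atom) (lsuc ℓ ⊔ k ⊔ m)
      u ∈ᶠ Fs = Factors (base u) Fs (from u) (to u)

      data _⊏_ : Rel Piece (ℓ ⊔ x) where
        shorter : ∀ {w c d d′ p q p′ q′} → d′ ⋖ d → piece w c d′ p′ q′ ⊏ piece w c d p q

      ⊏-wellFounded : WellFounded _⊏_
      ⊏-wellFounded u = go u (⋖-wellFounded (to u))
        where
        go : ∀ u → Acc _⋖_ (to u) → Acc _⊏_ u
        go u (acc rs) = acc λ { {piece _ _ _ _ _} (shorter lt) → go _ (rs lt) }

      ∈ᶠ-down : ∀ Fs {u v} → v ⊏ u → u ∈ᶠ Fs → v ∈ᶠ Fs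
      ∈ᶠ-down Fs {u} {v} (shorter lt) = factors-prefix (from⊴to v) (⋖⇒⊴ lt) (to⊴top u)

      module _ (noBad : NoBad _∈_) where

        -- Start at e₀ with the tail length minimal, so later tails have equal length. If none were
        -- recurrent, closures could shrink forever: letters of the tail lost at each stage would
        -- form a bad sequence.
        recurrent-tail : ∀ w {c d} → c ⋖ d → ∃[ e ] c ⊴ e × e ⋖ d × Recurrent w e d
        recurrent-tail w {c} {d} c⋖d
          with least (λ y → ∃[ e ] c ⊴ e × e ⋖ d × len e d ≡ y) (_ , c , ⊴-refl , c⋖d , refl)
        ... | y , (e₀ , c⊴e₀ , e₀⋖d , refl) , min = dne λ none →
          let step : ((e , _) : ∃[ e ] e₀ ⊴ e × e ⋖ d) →
                     ∃[ C ] ∃[ e′ ] e ⊴ e′ × e′ ⋖ d × AllIn w C e′ d ×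
                       ∃[ γ ] e ⊴ value γ × value γ ⋖ d × ¬ (letter w γ ∈ C)
              step = λ (e , e₀⊴e , e⋖d) → dne λ no →
                none (e , ⊴-trans c⊴e₀ e₀⊴e , e⋖d , λ e′ e⊴e′ e′⋖d →
                  ⊴-trans (len-anti e₀⊴e)
                          (min _ (e′ , ⊴-trans c⊴e₀ (⊴-trans e₀⊴e e⊴e′) , e′⋖d , refl)) ,
                  λ C all γ e⊴γ γ⋖d → dne λ ∉ → no (C , e′ , e⊴e′ , e′⋖d , all , γ , e⊴γ , γ⋖d , ∉))
          in noBad (BadProcess.run (record
            { State     = ∃[ e ] e₀ ⊴ e × e ⋖ d
            ; reach     = λ (e , _) y → ∃[ γ ] e ⊴ value γ × value γ ⋖ d × letter w γ ≡ y
            ; pick      = λ σ → let _ , _ , _ , _ , _ , γ , _ = step σ in letter w γ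
            ; code      = λ σ → proj₁ (step σ)
            ; next      = λ σ → let _ , e′ , e⊴e′ , e′⋖d , _ = step σ in
                                e′ , ⊴-trans (proj₁ (proj₂ σ)) e⊴e′ , e′⋖d
            ; pick∈     = λ σ → let _ , _ , _ , _ , _ , γ , e⊴γ , γ⋖d , _ = step σ in
                                γ , e⊴γ , γ⋖d , refl
            ; pick∉     = λ σ → let _ , _ , _ , _ , _ , _ , _ , _ , ∉ = step σ in ∉
            ; next⊆     = λ σ (γ , e′⊴γ , rest) → let _ , _ , e⊴e′ , _ = step σ in
                                γ , ⊴-trans e⊴e′ e′⊴γ , rest
            ; next⊆code = λ { σ (γ , e′⊴γ , γ⋖d , refl) → let _ , _ , _ , _ , all , _ = step σ in
                                all γ e′⊴γ γ⋖d }
            }) (e₀ , ⊴-refl , e₀⋖d))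

        module _ (w : ℕ → Word α X) (c d : ℕ → ⟪ α ⟫) where

          -- Choosing in each interval a letter outside its closed set turns a bad sequence of
          -- intervals into one of letters.
          AllIn-noBad : NoBad (λ n C → AllIn (w n) C (c n) (d n))
          AllIn-noBad β = noBad (record
            { point   = λ n → letter (w (point n)) (proj₁ (witness n))
            ; closed  = closed
            ; escapes = λ n → proj₂ (proj₂ (proj₂ (witness n)))
            ; later   = λ {i} {j} i<j → let γ , c⊴γ , γ⋖d , _ = witness j in later i<j γ c⊴γ γ⋖d
            })
            where
            open Bad β
            witness : ∀ n → ∃[ γ ] c (point n) ⊴ value γ × value γ ⋖ d (point n) ×
                                   ¬ (letter (w (point n)) γ ∈ closed n)
            witness n = dne λ no → escapes n λ γ c⊴γ γ⋖d → dne λ ∉ → no (γ , c⊴γ , γ⋖d , ∉)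

          -- First closures, then lengths are made self-convergent. Infinitely often the first
          -- factor stops short of the end and can be skipped by recurrence, or infinitely often it
          -- covers the whole interval and the other factors are empty.
          recurrent-selfConvergent : (∀ n → c n ⋖ d n) → (∀ n → Recurrent (w n) (c n) (d n)) →
            ∃[ φ ] Increasing φ × SelfConvergent (λ n Fs → Factors (w n) Fs (c n) (d n)) φ
          recurrent-selfConvergent c⋖d rec =
            let φ , φ-inc , sc₁ = noBad⇒selfConvergent AllIn-noBad id
            in combine φ φ-inc sc₁ (noBad⇒selfConvergent downSets-noBad (length ∘ φ))
            where
            length : ℕ → ⟪ α ⟫
            length n = len (c n) (d n)

            go : ∀ φ → SelfConvergent (λ n C → AllIn (w n) C (c n) (d n)) φ →
                 SelfConvergent (λ n B → holds B (length n)) φ →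
                 SelfConvergent (λ n Fs → Factors (w n) Fs (c n) (d n)) φ
            go φ sc₁ sc₂ [] inf with c (φ (proj₁ (inf 0))) | d (φ (proj₁ (inf 0)))
                                   | c⋖d (φ (proj₁ (inf 0))) | proj₂ (proj₂ (inf 0))
            ... | _ | _ | c⋖c | [] = contradiction c⋖c ⊴-refl
            go φ sc₁ sc₂ ((C , B) ∷ Fs) inf n with Infinitely-⊎ (Infinitely-map step inf)
              where
              step : ∀ n → Factors (w (φ n)) ((C , B) ∷ Fs) (c (φ n)) (d (φ n)) →
                     (∃[ y ] holds B y × Factors (w (φ n)) Fs (c (φ n)) (d (φ n))) ⊎
                     (AllIn (w (φ n)) C (c (φ n)) (d (φ n)) × holds B (len (c (φ n)) (d (φ n))) ×
                      Factors (w (φ n)) Fs (d (φ n)) (d (φ n)))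
              step n (cut e c⊴e all B∋ fs) with compare e (d (φ n))
              ... | tri< e⋖d _ _ = inj₁ (_ , B∋ , recurrent-extend (rec (φ n)) c⊴e e⋖d fs)
              ... | tri≈ _ refl _ = inj₂ (all , B∋ , fs)
              ... | tri> _ _ d⋖e = contradiction d⋖e (factors-⊴ fs)
            ... | inj₁ inf′ =
              cut-empty (proj₁ (proj₂ (proj₂ (proj₂ (inf′ 0)))))
                (go φ sc₁ sc₂ Fs (Infinitely-map (λ _ (_ , _ , fs) → fs) inf′) n)
            ... | inj₂ inf′ =
              cut (d (φ n)) (⋖⇒⊴ (c⋖d (φ n)))
                (sc₁ C (Infinitely-map (λ _ → proj₁) inf′) n)
                (sc₂ B (Infinitely-map (λ _ → proj₁ ∘ proj₂) inf′) n)
                (factors-empty (proj₂ (proj₂ (proj₂ (proj₂ (inf′ 0))))))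

            combine : ∀ φ → Increasing φ → SelfConvergent (λ n C → AllIn (w n) C (c n) (d n)) φ →
              ∃[ ψ ] Increasing ψ × SelfConvergent (λ x B → holds B x) (length ∘ φ ∘ ψ) →
              ∃[ χ ] Increasing χ × SelfConvergent (λ n Fs → Factors (w n) Fs (c n) (d n)) χ
            combine φ φ-inc sc₁ (ψ , ψ-inc , sc₂) =
              φ ∘ ψ , (λ i j i<j → φ-inc _ _ (ψ-inc i j i<j)) ,
              go (φ ∘ ψ) (λ C inf n → sc₁ C (Infinitely-reindex ψ-inc inf) (ψ n)) sc₂

        -- In a minimal bad sequence every piece is a proper prefix followed by a
        -- recurrent tail, and both range over Noetherian spaces.
        factors-noBad : NoBad _∈ᶠ_
        factors-noBad β₀ with minimalBad ⊏-wellFounded ∈ᶠ-down β₀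
        ... | β , _ , noBad′ =
          let φ , φ-inc , sc₁ = noBad⇒selfConvergent noBad′ (λ n → prefix n , n , prefix⊏ n)
          in combine φ φ-inc sc₁
               (recurrent-selfConvergent (base ∘ point ∘ φ) (cutAt ∘ φ) (to ∘ point ∘ φ)
                 (cutAt⋖to ∘ φ) (λ n → proj₂ (proj₂ (proj₂ (tails (φ n))))))
          where
          open Bad β

          -- An empty piece lies in every product containing some piece, and `closed n` contains the
          -- next point.
          nonempty : ∀ n → from (point n) ⋖ to (point n)
          nonempty n with ⋖-or-⊵ (from (point n)) (to (point n))
          ... | inj₁ lt = lt
          ... | inj₂ ge with ⊴-antisym (from⊴to (point n)) ge
          ...   | eq = contradiction
            (subst (Factors (base (point n)) (closed n) (from (point n))) eq
              (factors-empty (factors-prefix ⊴-refl (from⊴to (point (suc n)))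
                (to⊴top (point (suc n))) (later (ℕ.n<1+n n)))))
            (escapes n)

          tails : ∀ n → ∃[ e ] from (point n) ⊴ e × e ⋖ to (point n) ×
                               Recurrent (base (point n)) e (to (point n))
          tails n = recurrent-tail (base (point n)) (nonempty n)

          cutAt : ℕ → ⟪ α ⟫
          cutAt n = proj₁ (tails n)

          from⊴cutAt : ∀ n → from (point n) ⊴ cutAt n
          from⊴cutAt n = proj₁ (proj₂ (tails n))

          cutAt⋖to : ∀ n → cutAt n ⋖ to (point n)
          cutAt⋖to n = proj₁ (proj₂ (proj₂ (tails n)))

          prefix : ℕ → Piece
          prefix n = record
            { base    = base (point n)
            ; from    = from (point n)
            ; to      = cutAt n
            ; from⊴to = from⊴cutAt n
            ; to⊴top  = ⊴-trans (⋖⇒⊴ (cutAt⋖to n)) (to⊴top (point n))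
            }

          prefix⊏ : ∀ n → prefix n ⊏ point n
          prefix⊏ n = shorter (cutAt⋖to n)

          combine : ∀ φ → Increasing φ →
            SelfConvergent (λ n Fs → prefix n ∈ᶠ Fs) φ →
            ∃[ ψ ] Increasing ψ ×
              SelfConvergent (λ n Fs → Factors (base (point (φ n))) Fs (cutAt (φ n)) (to (point (φ n)))) ψ →
            ⊥
          combine φ φ-inc sc₁ (ψ , ψ-inc , sc₂) =
            bad⇒¬selfConvergent β {φ ∘ ψ} (λ i j i<j → φ-inc _ _ (ψ-inc i j i<j))
              (concat-selfConvergent (base ∘ point ∘ φ ∘ ψ) (from ∘ point ∘ φ ∘ ψ)
                (cutAt ∘ φ ∘ ψ) (to ∘ point ∘ φ ∘ ψ)
                (λ n → ⋖⇒⊴ (cutAt⋖to (φ (ψ n))))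
                (λ C inf n → sc₁ C (Infinitely-reindex ψ-inc inf) (ψ n)) sc₂
                (λ n → from⊴cutAt (φ (ψ n))))

    -- Concatenations of words and cut points.

    len-injective : ∀ {c x y} → c ⊴ x → c ⊴ y → len c x ≡ len c y → x ≡ y
    len-injective c⊴x c⊴y eq = ⊴-antisym
      (λ y⋖x → ⊴-reflexive eq (len-mono-⋖ c⊴y y⋖x))
      (λ x⋖y → ⊴-reflexive (sym eq) (len-mono-⋖ c⊴x x⋖y))

    shorterThan : Ordinal ℓ → DownSet
    shorterThan β = record { holds = λ t → (α ↓ t) ≺ β ; down = restrict }
      where
      restrict : ∀ {x y} → y ⊴ x → (α ↓ x) ≺ β → (α ↓ y) ≺ β
      restrict {x} {y} y⊴x (b , g , iso) with compare y x
      ... | tri≈ _ refl _ = b , g , iso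
      ... | tri> _ _ x⋖y  = contradiction x⋖y y⊴x
      ... | tri< y⋖x _ _  =
        -- The isomorphism onto an initial segment of β restricts to one from the positions before y
        -- onto those before the image of y.
        value (g (y , [ y⋖x ])) ,
        (λ γ → value (g (incl γ)) , [ mono {incl γ} {y , [ y⋖x ]} (bound α γ) ]) ,
        mono-surjective⇒iso (α ↓ y) (β ↓ value (g (y , [ y⋖x ])))
          (λ {γ} {δ} → mono {incl γ} {incl δ})
          (λ δ → let γ , eq = surjection {β = α ↓ x} {β ↓ b} iso
                                (value δ , [ Ordinal.<-trans β (bound β δ)
                                               (bound β (g (y , [ y⋖x ]))) ])
                     eq′ = cong value eq
                 in (value γ , [ mono⇒reflects (α ↓ x) (β ↓ b) {g} (λ {γ} {δ} → mono {γ} {δ})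
                                   {γ} {y , [ y⋖x ]}
                                   (subst (λ t → β [ t < value (g (y , [ y⋖x ])) ]) (sym eq′)
                                          (bound β δ)) ]) ,
                    value-injective eq′)
        where
        open IsOrderIsomorphism iso using (mono)
        incl : ⟪ α ↓ y ⟫ → ⟪ α ↓ x ⟫
        incl γ = value γ , [ ⋖-trans (bound α γ) y⋖x ]

    module _ {X : Set ℓ} where

      -- Exhibits v as the factor of w on [c , d), linking words with positions of their own to
      -- intervals of w.
      record Copy (v w : Word α X) (c d : ⟪ α ⟫) : Set ℓ where
        field
          to      : ⟪ ∣ v ∣ ⟫ → ⟪ ∣ w ∣ ⟫
          mono    : ∀ {γ δ} → value γ ⋖ value δ → value (to γ) ⋖ value (to δ)
          above   : ∀ γ → c ⊴ value (to γ)
          below   : ∀ γ → value (to γ) ⋖ d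
          onto    : ∀ δ → c ⊴ value δ → value δ ⋖ d → ∃[ γ ] to γ ≡ δ
          letters : ∀ γ → letter v γ ≡ letter w (to γ)

        injective : ∀ {γ δ} → to γ ≡ to δ → γ ≡ δ
        injective = mono⇒injective ∣ v ∣ ∣ w ∣ (λ {γ} {δ} → mono {γ} {δ})

        reflects : ∀ {γ δ} → value (to γ) ⋖ value (to δ) → value γ ⋖ value δ
        reflects {γ} {δ} = mono⇒reflects ∣ v ∣ ∣ w ∣ {to} (λ {γ} {δ} → mono {γ} {δ}) {γ} {δ}

      copy-whole : ∀ w {c} → (∀ y → c ⊴ y) → Copy w w c (top w)
      copy-whole w c⊴ = record
        { to      = id
        ; mono    = id
        ; above   = λ γ → c⊴ (value γ)
        ; below   = bound α
        ; onto    = λ δ _ _ → δ , refl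
        ; letters = λ _ → refl
        }

      module _ (w : Word α X) (c : ⟪ α ⟫) {d : ⟪ α ⟫} (d⊴top : d ⊴ top w) where

        private
          at : (γ : ⟪ α ↓ len c d ⟫) → ∃[ x ] c ⊴ x × x ⋖ d × len c x ≡ value γ
          at γ = len-surjective (bound α γ)

          place : ⟪ α ↓ len c d ⟫ → ⟪ ∣ w ∣ ⟫
          place γ = let x , _ , x⋖d , _ = at γ in x , [ ⋖-⊴-trans x⋖d d⊴top ]

        factor : Word α X
        factor = word (len c d) (letter w ∘ place)

        copy-factor : Copy factor w c d
        copy-factor = record
          { to      = place
          ; mono    = λ {γ} {δ} lt →
              let _ , c⊴x , _ , eq = at γ ; _ , c⊴y , _ , eq′ = at δ
              in len-reflects-⋖ c⊴y (subst (_⋖ len c (proj₁ (at δ))) (sym eq)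
                                            (subst (value γ ⋖_) (sym eq′) lt))
          ; above   = λ γ → proj₁ (proj₂ (at γ))
          ; below   = λ γ → proj₁ (proj₂ (proj₂ (at γ)))
          ; onto    = λ δ c⊴δ δ⋖d →
              let γ = len c (value δ) , [ len-mono-⋖ c⊴δ δ⋖d ]
                  _ , c⊴x , _ , eq = at γ
              in γ , value-injective (len-injective c⊴x c⊴δ eq)
          ; letters = λ _ → refl
          }

      ≺-copy : ∀ {v w c d β} → d ⊴ top w → Copy v w c d → ∣ v ∣ ≺ β → (α ↓ len c d) ≺ β
      ≺-copy {v} {w} {c} {d} {β} d⊴top copy = ≺-image {β = ∣ v ∣} {α ↓ len c d} {β}
        {λ γ → len c (value (to γ)) , [ len-mono-⋖ (above γ) (below γ) ]}
        (λ {γ} {δ} lt → len-mono-⋖ (above γ) (mono {γ} {δ} lt))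
        (λ y → let x , c⊴x , x⋖d , eq = len-surjective (bound α y)
                   γ , eq′ = onto (x , [ ⋖-⊴-trans x⋖d d⊴top ]) c⊴x x⋖d
               in γ , value-injective (trans (cong (λ δ → len c (value δ)) eq′) eq))
        where
        open Copy copy

      module _ {q} (O : Pred (Pred X q) r) where

        Code : Set (ℓ ⊔ lsuc q ⊔ r)
        Code = Σ[ F ∈ Pred X q ] ∁ F ∈ O

        _∈ᶜ_ : REL X Code q
        x ∈ᶜ (F , _) = F x

        atoms : {Fs : List (Pred X q × Ordinal ℓ)} →
                All (λ Fβ → ∁ (proj₁ Fβ) ∈ O) Fs → List (Code × DownSet)
        atoms []                       = []
        atoms (_∷_ {x = F , β} F∈O os) = ((F , F∈O) , shorterThan β) ∷ atoms os

        -- The cut is the first position in w of the second word of the concatenation, or d when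
        -- that word is empty.
        product⇒factors : ∀ {Fs} (os : All (λ Fβ → ∁ (proj₁ Fβ) ∈ O) Fs) {v w c d} →
          c ⊴ d → d ⊴ top w → Copy v w c d → product Fs v → Factors _∈ᶜ_ w (atoms os) c d
        product⇒factors [] {c = c} {d} c⊴d d⊴top copy empty with compare c d
        ... | tri< c⋖d _ _ = let γ , _ = Copy.onto copy (c , [ ⋖-⊴-trans c⋖d d⊴top ])
                                           ⊴-refl c⋖d
                             in case empty γ of λ ()
        ... | tri≈ _ refl _ = []
        ... | tri> _ _ d⋖c  = contradiction d⋖c c⊴d
        product⇒factors (_∷_ {x = F , β} F∈O os) {v} {w} {c} {d} c⊴d d⊴top copy
                        (u , v′ , (u≺β , u∈F) , v′∈Fs , f , iso , letters-f) =
          cut e c⊴e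
            (λ γ c⊴γ γ⋖e → let δ , eq = Copy.onto copy-u γ c⊴γ γ⋖e in
               subst F (trans (Copy.letters copy-u δ) (cong (letter w) eq)) (u∈F δ))
            (≺-copy {u} {w} {β = β} (⊴-trans e⊴d d⊴top) copy-u u≺β)
            (product⇒factors os e⊴d d⊴top copy-v′ v′∈Fs)
          where
          open Copy copy
          module Iso = IsOrderIsomorphism iso

          After : Pred ⟪ α ⟫ ℓ
          After x = c ⊴ x × (x ≡ d ⊎ ∃[ δ ] value (to (f (inj₂ δ))) ≡ x)

          split : ∃[ x ] After x × (∀ y → After y → x ⊴ y)
          split = least After (d , c⊴d , inj₁ refl)

          e : ⟪ α ⟫
          e = proj₁ split

          c⊴e : c ⊴ e
          c⊴e = proj₁ (proj₁ (proj₂ split))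

          e⊴d : e ⊴ d
          e⊴d = proj₂ (proj₂ split) d (c⊴d , inj₁ refl)

          inj₁-below : ∀ γ → value (to (f (inj₁ γ))) ⋖ e
          inj₁-below γ with proj₂ (proj₁ (proj₂ split))
          ... | inj₁ eq       = subst (value (to (f (inj₁ γ))) ⋖_) (sym eq) (below _)
          ... | inj₂ (δ , eq) = subst (value (to (f (inj₁ γ))) ⋖_) eq
                                      (mono {f (inj₁ γ)} {f (inj₂ δ)} (Iso.mono ₁∼₂))

          inj₂-above : ∀ δ → e ⊴ value (to (f (inj₂ δ)))
          inj₂-above δ = proj₂ (proj₂ split) _ (above _ , inj₂ (δ , refl))

          copy-u : Copy u w c e
          copy-u = record
            { to      = to ∘ f ∘ inj₁
            ; mono    = λ {γ} {δ} lt → mono {f (inj₁ γ)} {f (inj₁ δ)} (Iso.mono (₁∼₁ lt))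
            ; above   = λ γ → above _
            ; below   = inj₁-below
            ; onto    = onto₁
            ; letters = λ γ → trans (sym (letters-f (inj₁ γ))) (letters (f (inj₁ γ)))
            }
            where
            onto₁ : ∀ δ → c ⊴ value δ → value δ ⋖ e → ∃[ γ ] to (f (inj₁ γ)) ≡ δ
            onto₁ δ c⊴δ δ⋖e with onto δ c⊴δ (⋖-⊴-trans δ⋖e e⊴d)
            ... | ε , refl with surjection {β = ∣ u ∣ ⊕ ∣ v′ ∣} {∣ v ∣} iso ε
            ...   | inj₁ γ , refl = γ , refl
            ...   | inj₂ γ , refl = contradiction δ⋖e (inj₂-above γ)

          copy-v′ : Copy v′ w e d
          copy-v′ = record
            { to      = to ∘ f ∘ inj₂
            ; mono    = λ {γ} {δ} lt → mono {f (inj₂ γ)} {f (inj₂ δ)} (Iso.mono (₂∼₂ lt))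
            ; above   = inj₂-above
            ; below   = λ γ → below _
            ; onto    = onto₂
            ; letters = λ γ → trans (sym (letters-f (inj₂ γ))) (letters (f (inj₂ γ)))
            }
            where
            onto₂ : ∀ δ → e ⊴ value δ → value δ ⋖ d → ∃[ γ ] to (f (inj₂ γ)) ≡ δ
            onto₂ δ e⊴δ δ⋖d with onto δ (⊴-trans c⊴e e⊴δ) δ⋖d
            ... | ε , refl with surjection {β = ∣ u ∣ ⊕ ∣ v′ ∣} {∣ v ∣} iso ε
            ...   | inj₁ γ , refl = contradiction (inj₁-below γ) e⊴δ
            ...   | inj₂ γ , refl = γ , refl

        -- Both sides of the cut are realised as words by `factor`; matching positions through w
        -- yields the concatenation isomorphism.
        factors⇒product : ∀ {Fs} (os : All (λ Fβ → ∁ (proj₁ Fβ) ∈ O) Fs) {v w c d} →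
          d ⊴ top w → Copy v w c d → Factors _∈ᶜ_ w (atoms os) c d → product Fs v
        factors⇒product [] d⊴top copy [] γ = contradiction (Copy.below copy γ) (Copy.above copy γ)
        factors⇒product (_∷_ {x = F , β} F∈O os) {v} {w} {c} {d} d⊴top copy (cut e c⊴e all short fs) =
          u , v′ , (short , λ γ → all _ (U.above γ) (U.below γ)) ,
          factors⇒product os d⊴top copy-v′ fs ,
          f , mono-surjective⇒iso (∣ u ∣ ⊕ ∣ v′ ∣) ∣ v ∣ (λ {i} {j} → f-mono {i} {j}) f-surjective ,
          f-letters
          where
          open Copy copy

          e⊴d : e ⊴ d
          e⊴d = factors-⊴ _∈ᶜ_ fs

          e⊴top : e ⊴ top w
          e⊴top = ⊴-trans e⊴d d⊴top

          u v′ : Word α X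
          u  = factor w c e⊴top
          v′ = factor w e d⊴top

          copy-u : Copy u w c e
          copy-u = copy-factor w c e⊴top

          copy-v′ : Copy v′ w e d
          copy-v′ = copy-factor w e d⊴top

          module U = Copy copy-u
          module V = Copy copy-v′

          place : ⟪ ∣ u ∣ ⊕ ∣ v′ ∣ ⟫ → ⟪ ∣ w ∣ ⟫
          place (inj₁ γ) = U.to γ
          place (inj₂ γ) = V.to γ

          pre : ∀ i → ∃[ γ ] to γ ≡ place i
          pre (inj₁ γ) = onto (U.to γ) (U.above γ) (⋖-⊴-trans (U.below γ) e⊴d)
          pre (inj₂ γ) = onto (V.to γ) (⊴-trans c⊴e (V.above γ)) (V.below γ)

          f : ⟪ ∣ u ∣ ⊕ ∣ v′ ∣ ⟫ → ⟪ ∣ v ∣ ⟫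
          f i = proj₁ (pre i)

          place-mono : ∀ {i j} → (∣ u ∣ ⊕ ∣ v′ ∣) [ i < j ] → value (place i) ⋖ value (place j)
          place-mono (₁∼₂ {γ} {δ})    = ⋖-⊴-trans (U.below γ) (V.above δ)
          place-mono (₁∼₁ {γ} {δ} lt) = U.mono {γ} {δ} lt
          place-mono (₂∼₂ {γ} {δ} lt) = V.mono {γ} {δ} lt

          f-mono : ∀ {i j} → (∣ u ∣ ⊕ ∣ v′ ∣) [ i < j ] → ∣ v ∣ [ f i < f j ]
          f-mono {i} {j} lt = reflects {f i} {f j}
            (subst (λ γ → value γ ⋖ value (to (f j))) (sym (proj₂ (pre i)))
              (subst (λ γ → value (place i) ⋖ value γ) (sym (proj₂ (pre j))) (place-mono lt)))

          f-surjective : ∀ γ → ∃[ i ] f i ≡ γ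
          f-surjective γ with ⋖-or-⊵ (value (to γ)) e
          ... | inj₁ lt = let δ , eq = U.onto (to γ) (above γ) lt
                          in inj₁ δ , injective (trans (proj₂ (pre (inj₁ δ))) eq)
          ... | inj₂ ge = let δ , eq = V.onto (to γ) ge (below γ)
                          in inj₂ δ , injective (trans (proj₂ (pre (inj₂ δ))) eq)

          f-letters : ∀ i → letter v (f i) ≡ Sum.[ letter u , letter v′ ] i
          f-letters (inj₁ γ) = trans (letters (f (inj₁ γ))) (cong (letter w) (proj₂ (pre (inj₁ γ))))
          f-letters (inj₂ γ) = trans (letters (f (inj₂ γ))) (cong (letter w) (proj₂ (pre (inj₂ γ))))

    -- Restricted alphabets and the subword topology.

    module _ {X : Set x} {Y : Set z} (f : Y → X) where

      relabel : Word α Y → Word α X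
      relabel w = word (top w) (f ∘ letter w)

      module _ {K : Set k} (_∈_ : REL X K m) where

        factors-relabel⁺ : ∀ {w Fs c d} → Factors (λ y C → f y ∈ C) w Fs c d →
                           Factors _∈_ (relabel w) Fs c d
        factors-relabel⁺ []                      = []
        factors-relabel⁺ (cut e c⊴e all len fs) = cut e c⊴e all len (factors-relabel⁺ fs)

        factors-relabel⁻ : ∀ {w Fs c d} → Factors _∈_ (relabel w) Fs c d →
                           Factors (λ y C → f y ∈ C) w Fs c d
        factors-relabel⁻ []                      = []
        factors-relabel⁻ (cut e c⊴e all len fs) = cut e c⊴e all len (factors-relabel⁻ fs)

    module _ {X : Set ℓ} (O : Pred (Pred X q) r) where

      -- A word supplies an element of α; the least element is where all words begin.
      bottom : Word α X → ∃[ c ] ∀ y → c ⊴ y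
      bottom w = let c , _ , c⊴ = least {p = ℓ} (λ _ → ⊤) (top w , tt) in c , λ y → c⊴ y tt

      -- Closed sets of letters are downward closed, so `factors-embed` makes products downward
      -- closed for the Higman ordering.
      subwordOpen-upward : {_≼_ : Rel X s} → (∀ {P} → O P → ∀ {y z} → y ≼ z → P y → P z) →
        ∀ {V} → SubwordOpen α O V → ∀ {v w} → Higman _≼_ v w → V v → V w
      subwordOpen-upward {_≼_ = _≼_} up = generated-upward λ
        { (Fs , os , V⊆ , ⊆V) {v} {w} (h , mono , v≼w) Vv →
          let c , c⊴ = bottom v in
          ⊆V λ w∈Fs → V⊆ Vv (factors⇒product O os ⊴-refl (copy-whole v c⊴)
            (factors-embed (_∈ᶜ_ O) h mono
              (λ (F , F∈O) γ Fw → dne λ ¬Fv → up F∈O (v≼w γ) ¬Fv Fw)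
              (c⊴ (top v)) ⊴-refl (λ γ _ _ → c⊴ (value (h γ)) , bound α (h γ))
              (product⇒factors O os (c⊴ (top w)) ⊴-refl
                (copy-whole w c⊴) w∈Fs))) }

      -- Only the letters that occur need form a Noetherian space Y, while the open sets concern
      -- words over X.
      subword-selfConvergent : {Y : Set ℓ} (f : Y → X) →
        NoBad (λ y (C : Code O) → _∈ᶜ_ O (f y) C) →
        (w : ℕ → Word α Y) →
        ∃[ φ ] Increasing φ × (∀ {V} → SubwordOpen α O V → ∀ n →
          V (relabel f (w (φ n))) →
          Eventually (λ m → V (relabel f (w (φ m)))))
      subword-selfConvergent {Y} f noBad w =
        let φ , φ-inc , sc = noBad⇒selfConvergent (factors-noBad _ noBad) pieces
        in φ , φ-inc , generated-eventually (basic-eventually φ sc)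
        where
        w′ : ℕ → Word α X
        w′ n = relabel f (w n)

        c  = proj₁ (bottom (w′ 0))
        c⊴ = proj₂ (bottom (w′ 0))

        pieces : ℕ → Piece (λ y C → _∈ᶜ_ O (f y) C)
        pieces n = piece (w n) c (top (w n)) (c⊴ _) ⊴-refl

        basic-eventually : ∀ φ →
          SelfConvergent (λ n Fs → Factors (λ y C → _∈ᶜ_ O (f y) C) (w n) Fs c (top (w n))) φ →
          ∀ {V} → SubwordBasis α O V → ∀ n → V (w′ (φ n)) → Eventually (V ∘ w′ ∘ φ)
        basic-eventually φ sc (Fs , os , V⊆ , ⊆V) n Vwn =
          let N , h = ¬infinitely⇒eventually λ inf → V⊆ Vwn
                        (factors⇒product O os ⊴-refl (copy-whole _ c⊴)
                          (factors-relabel⁺ f _ (sc (atoms O os) inf n)))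
          in N , λ m N≤m → ⊆V λ w∈Fs → h m N≤m
                   (factors-relabel⁻ f _
                     (product⇒factors O os (c⊴ _) ⊴-refl (copy-whole _ c⊴) w∈Fs))

    -- Trees

    module _ {A : Set ℓ} (θ : Topology A ℓ) where

      private
        T = Tree α A
        O = TreeOpen θ α

      specialisation-trans : ∀ {a b c} → Specialisation θ a b → Specialisation θ b c →
                             Specialisation θ a c
      specialisation-trans a≤b b≤c P P∈θ = b≤c P P∈θ ∘ a≤b P P∈θ

      treeOpen-upward : ∀ {W} → O W → ∀ {s t} → _≤ₜ_ θ α s t → W s → W t
      treeOpen-upward (fix g) = generated-upward
        (λ (P , V , _ , _ , W⊆ , ⊆W) s≤t Ws →
          let z , z∈ , z≤s = W⊆ Ws in ⊆W (z , z∈ , Embeds-trans specialisation-trans z≤s s≤t)) g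

      Basic : Set _
      Basic = Σ[ W ∈ Pred T (lsuc ℓ) ] TreeBasis θ α O W

      basic-down : ∀ (C : Basic) {s t} → t ◁ s → s ∉ᵒ C → t ∉ᵒ C
      basic-down (W , P , V , _ , _ , W⊆ , ⊆W) (subtree γ) ∉ Wt =
        let z , z∈ , z≤t = W⊆ Wt in ∉ (⊆W (z , z∈ , child γ z≤t))

      treeBasis-noBad : Noetherian θ → NoBad (λ t (C : Basic) → t ∉ᵒ C)
      treeBasis-noBad noeth β₀ with minimalBad ◁-wellFounded basic-down β₀
      ... | β , below∉ , noBad =
        let φ , φ-inc , words = subword-selfConvergent O proj₁ letters-noBad wordsʸ
        in combine φ φ-inc words
             (noBad⇒selfConvergent (noetherian⇒noBad θ noeth) (root ∘ φ))
        where
        open Bad β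

        Y : Set ℓ
        Y = Σ[ t ∈ T ] ∃[ n ] t ◁ point n

        -- Escaping a closed set means lying above some tree of `P ⟨ V ⟩ₛ`, which a leaf does not.
        node-shape : ∀ n → ∃[ a ] ∃[ w ] point n ≡ a ⟨ w ⟩
        node-shape n with closed n | escapes n
        ... | W , P , V , _ , _ , W⊆ , _ | W∋ with W⊆ (dne W∋)
        ...   | z , node _ _ , z≤t = shape z≤t
          where
          shape : ∀ {b v t} → _≤ₜ_ θ α (b ⟨ v ⟩) t → ∃[ a ] ∃[ w ] t ≡ a ⟨ w ⟩
          shape (child γ _) = _ , _ , refl
          shape (node _ _)  = _ , _ , refl

        root : ℕ → A
        root n = proj₁ (node-shape n)

        children : ℕ → Word α T
        children n = proj₁ (proj₂ (node-shape n))

        point≡ : ∀ n → point n ≡ root n ⟨ children n ⟩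
        point≡ n = proj₂ (proj₂ (node-shape n))

        child◁ : ∀ n γ → letter (children n) γ ◁ point n
        child◁ n γ = subst (letter (children n) γ ◁_) (sym (point≡ n)) (subtree γ)

        wordsʸ : ℕ → Word α Y
        wordsʸ n = word (top (children n)) λ γ → letter (children n) γ , n , child◁ n γ

        -- Minimality speaks only of basic open sets; the subbase lemma extends it to all tree-open
        -- sets.
        letters-noBad : NoBad (λ (y : Y) (C : Code O) → _∈ᶜ_ O (proj₁ y) C)
        letters-noBad γ = generated-noBad proj₁ noBad (record
          { point   = Bad.point γ
          ; closed  = λ n → let F , ∁F∈O = Bad.closed γ n in ∁ F , unfix θ α ∁F∈O
          ; escapes = λ n ∉ → ∉ (Bad.escapes γ n)
          ; later   = λ i<j ∁F → ∁F (Bad.later γ i<j)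
          })

        combine : ∀ φ → Increasing φ →
          (∀ {V} → SubwordOpen α O V → ∀ n → V (children (φ n)) → Eventually (V ∘ children ∘ φ)) →
          ∃[ ψ ] Increasing ψ ×
            SelfConvergent (λ a (P : Σ[ P ∈ Pred A ℓ ] P ∈ Open θ) → a ∉ᵒ P) (root ∘ φ ∘ ψ) → ⊥
        combine φ φ-inc words (ψ , ψ-inc , roots) with closed i | escapes i | below∉ i | (λ {j} → later {i} {j})
          where
          i = φ (ψ 0)
        ... | W , P , V , P∈θ , V-open , W⊆ , ⊆W | W∋ | below | after
          with W⊆ (dne W∋)
        ...   | _ , node {w = v} b∈P v∈V , z≤t with subst (_≤ₜ_ θ α _) (point≡ (φ (ψ 0))) z≤t
        -- Then a child would belong to W, but by minimality W contains no child of this point.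
        ...     | child γ z≤s = below _ (child◁ _ γ) (⊆W (_ , node b∈P v∈V , z≤s))
        ...     | node b≤a v≤w =
          let N  , h  = words V-open (ψ 0)
                          (subwordOpen-upward O treeOpen-upward V-open v≤w v∈V)
              N′ , h′ = ¬infinitely⇒eventually λ inf → roots (P , P∈θ) inf 0 (b≤a P P∈θ b∈P)
              -- The successor makes the term strictly later than the first. N counts along φ and N′
              -- along `φ ∘ ψ`, and `ψ m` is at least m. This later term lies in W, contradicting
              -- badness.
              m = suc (N ℕ.⊔ N′)
          in after (φ-inc _ _ (ψ-inc 0 m (s≤s z≤n)))
               (⊆W (_ , node (dne (h′ m (ℕ.≤-trans (ℕ.m≤n⊔m N N′) (ℕ.n≤1+n _))))
                             (h (ψ m) (ℕ.≤-trans (ℕ.≤-trans (ℕ.m≤m⊔n N N′) (ℕ.n≤1+n _))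
                                                 (increasing-≥ ψ-inc m))) ,
                    subst (_≤ₜ_ θ α _) (sym (point≡ _)) (Embeds-refl (λ _ _ → id))))

mainTheorem3 : (∀ (e : Level) → ExcludedMiddle e) →
    ∀ {ℓ : Level} {A : Set ℓ} (θ : Topology A ℓ) → Noetherian θ →
    (α : Ordinal ℓ) → Noetherian (treeTopology θ α)
mainTheorem3 em θ noeth α = noBad⇒noetherian em (treeTopology θ α) λ β →
  -- Unfolding the fixed point once presents tree-open sets as generated by the tree basis, on which
  -- badness has been excluded.
  generated-noBad em id (treeBasis-noBad em α θ noeth) (record
    { point   = Bad.point β
    ; closed  = λ n → let W , W-open = Bad.closed β n in W , unfix θ α W-open
    ; escapes = Bad.escapes β
    ; later   = Bad.later β
    })
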